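{- For every integer $k \ge 4$ and every integer $\ell \ge 1$ there exists a finite point set $X_{k,\ell}\subset\mathbb{R}^k$ such that, when greedy $k$-means++ with parameter $\ell$ is run on $X_{k,\ell}$, the expected approximation ratio $\mathbb{E}[\Phi(X_{k,\ell},C)]/\mathrm{OPT}_k(X_{k,\ell})$ of the computed center set $C$ is $\Omega\big(\min\{\ell, k/\log k\}\cdot \log k\big)$.
   Context: For a finite (multi)set $X\subset\mathbb{R}^d$ and a finite center set $C\subset\mathbb{R}^d$, the $k$-means cost is $\Phi(X,C)=\sum_{x\in X}\min_{c\in C}\|x-c\|^2$, and $\mathrm{OPT}_k(X)=\min_{C\subset\mathbb{R}^d,|C|=k}\Phi(X,C)$. Greedy $k$-means++ with parameter $\ell$ on input $X$ works as follows: sample a point $c_1$ uniformly at random from $X$ and set $C=\{c_1\}$; then for $i=2,\dots,k$: define $p(x)=\min_{c\in C}\|x-c\|^2/\sum_{y\in X}\min_{c\in C}\|y-c\|^2$ for $x\in X$ ($D^2$-sampling), sample a set $S$ of $\ell$ points independently according to $p$, let $c_i=\arg\min_{u\in S}\Phi(X,C\cup\{u\})$, and set $C=C\cup\{c_i\}$. The output is the resulting set $C$ of $k$ centers. -}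

module Defs where

open import Data.Nat as ℕ using (ℕ; zero; suc; _∸_)
open import Data.Nat.Logarithm using (⌊log₂_⌋)
open import Data.Integer using (+_; +[1+_]; -[1+_])
open import Data.Rational using (ℚ; mkℚ; 0ℚ; _+_; _*_; _-_; _÷_; _⊓_; _≤ᵇ_)
import Data.Rational as Q
open import Data.Bool using (if_then_else_; not)
open import Data.List using (List; []; _∷_; map; concatMap; length)
open import Data.Vec using (Vec; zipWith; toList)
import Data.Vec as V

Point : ℕ → Set
Point k = Vec ℚ k

-- total division on ℚ (q = 0 gives 0; only used where q ≠ 0)
_/'_ : ℚ → ℚ → ℚ
p /' mkℚ (+ 0) d c = 0ℚ
p /' q@(mkℚ +[1+ n ] d c) = p ÷ q
p /' q@(mkℚ -[1+ n ] d c) = p ÷ q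

ℕtoℚ : ℕ → ℚ
ℕtoℚ n = (+ n) Q./ 1

sumℚ : List ℚ → ℚ
sumℚ [] = 0ℚ
sumℚ (x ∷ xs) = x + sumℚ xs

prodℚ : List ℚ → ℚ
prodℚ [] = Q.1ℚ
prodℚ (x ∷ xs) = x * prodℚ xs

dist² : ∀ {d} → Point d → Point d → ℚ
dist² x y = V.foldr _ _+_ 0ℚ (zipWith (λ a b → (a - b) * (a - b)) x y)

-- min_{c ∈ C} ‖x - c‖²   (C is always nonempty where used)
costTo : ∀ {d} → Point d → List (Point d) → ℚ
costTo x [] = 0ℚ
costTo x (c ∷ []) = dist² x c
costTo x (c ∷ c' ∷ cs) = dist² x c ⊓ costTo x (c' ∷ cs)

-- k-means cost Φ(X, C) of the multiset X (a list) w.r.t. centers C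
Φ : ∀ {d} → List (Point d) → List (Point d) → ℚ
Φ X C = sumℚ (map (λ x → costTo x C) X)

seqs : ∀ {A : Set} → ℕ → List A → List (List A)
seqs zero xs = [] ∷ []
seqs (suc l) xs = concatMap (λ x → map (x ∷_) (seqs l xs)) xs

-- argmin_{u ∈ S} Φ(X, C ∪ {u}), ties broken by the first minimiser in S
bestFrom : ∀ {d} → List (Point d) → List (Point d) → Point d → List (Point d) → Point d
bestFrom X C u [] = u
bestFrom X C u (v ∷ vs) =
  if not (Φ X (u ∷ C) ≤ᵇ Φ X (v ∷ C)) then bestFrom X C v vs else bestFrom X C u vs

-- Expected final cost when m more greedy steps (with parameter l) are performed
-- starting from the current center set C.
greedyExp : ∀ {d} → (l : ℕ) → (X : List (Point d)) → ℕ → List (Point d) → ℚ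
greedyExp l X zero C = Φ X C
greedyExp {d} l X (suc m) C =
  if Φ X C ≤ᵇ 0ℚ then Φ X C
  else sumℚ (map step (seqs l X))
  where
    prob : List (Point d) → ℚ
    prob S = prodℚ (map (λ s → costTo s C /' Φ X C) S)
    step : List (Point d) → ℚ
    step [] = greedyExp l X m C
    step (s ∷ S) = prob (s ∷ S) * greedyExp l X m (bestFrom X C s S ∷ C)

greedyKMeansPPExpectedCost : ∀ {d} → (k l : ℕ) → List (Point d) → ℚ
greedyKMeansPPExpectedCost k l X =
  sumℚ (map (λ x → greedyExp l X (k ∸ 1) (x ∷ [])) X) /' ℕtoℚ (length X)

bound : ℕ → ℕ → ℚ
bound k l = (ℕtoℚ l ⊓ (ℕtoℚ k /' ℕtoℚ L)) * ℕtoℚ L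
  where L = ⌊log₂ k ⌋

{-# OPTIONS --safe #-}

-- X consists of the origin and M = ℓL copies of each unit vector of ℚᵏ, L = ⌊log₂ k⌋. The k unit
-- vectors are centers of cost 1, while any k centers from X that include the origin leave a unit
-- vector uncovered and hence cost at least M. As long as m ≥ 2 unit vectors are uncovered and the
-- origin is not a center, the cost is 2Mm + 1 and the origin lowers it more than any unit vector
-- does, so greedy takes the origin whenever it is sampled; it is missed by all ℓ samples with
-- probability (2Mm / (2Mm + 1))^ℓ ≤ 1 / (1 + 1/(2Lm)). Since ∑ 1/m over 2 ≤ m < k is at least
-- (L - 1)/2, the origin is taken with probability at least 1/9.

module Submission where

-- The multiplicity M balances two demands. A run that takes the origin pays at least M against an
-- optimum of at most 1, so M should be large. But the origin carries cost 1 among 2Mm + 1, so a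
-- round takes it with probability about ℓ/(2Mm), and over all rounds these add up to the order of
-- (ℓ/M) log k. The choice M = ℓL is the largest order that keeps this sum bounded below. The
-- constant 1/9 comes from L = 2, the smallest value that k ≥ 4 allows: the product of the factors 1
-- + 1/(2Lm) is at least 1 + (L - 1)/(4L) ≥ 9/8. The state of the run is random, so the induction
-- follows one invariant: as many steps remain as unit vectors are uncovered. A step that covers no
-- new unit vector breaks it for good and forces cost M, whatever the reason; a step that covers one
-- preserves it. The expected cost is then bounded below by M minus a product with one factor per
-- round.

open import Defs
open import Data.Bool using (true; false; if_then_else_)
open import Data.Empty using (⊥-elim)
open import Data.Fin as Fin using (Fin; zero; suc)
import Data.Fin.Properties as Fin
open import Data.Integer as ℤ using (-[1+_]; +[1+_])
import Data.Integer.Properties as ℤ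
open import Data.List using (List; []; _∷_; map; concatMap; length; _++_; replicate; tabulate; allFin)
open import Data.List.Membership.DecPropositional using (_∈?_)
open import Data.List.Membership.Propositional using (_∈_; _∉_)
open import Data.List.Membership.Propositional.Properties using (∈-map⁺; ∈-map⁻; ∈-allFin; ∈-concat⁺′)
open import Data.List.Properties using (map-∘; map-cong; map-++; map-tabulate; length-map; length-tabulate)
open import Data.List.Relation.Unary.Any using (here; there)
open import Data.Nat as ℕ using (ℕ; zero; suc; z≤n; s≤s)
open import Data.Nat.Induction using (<-rec)
open import Data.Nat.Logarithm using (⌊log₂_⌋; ⌊log₂⌋-mono-≤; ⌊log₂[2^n]⌋≡n; ⌊log₂⌊n/2⌋⌋≡⌊log₂n⌋∸1)
import Data.Nat.Properties as ℕ
open import Data.Product using (Σ; _×_; _,_; ∃; proj₁; proj₂)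
open import Data.Rational
open import Data.Rational.Properties
open import Data.Rational.Solver using (module +-*-Solver)
import Data.Rational.Unnormalised as ℚᵘ
import Data.Rational.Unnormalised.Properties as ℚᵘ
open import Data.Sum using (_⊎_; inj₁; inj₂)
open import Data.Unit using (tt)
open import Data.Vec as Vec using (Vec)
import Data.Vec.Membership.Propositional.Properties as Vec
import Data.Vec.Relation.Unary.Any as VecAny
open import Data.Vec.Relation.Unary.Any.Properties using (lookup-index)
open import Function using (_∘_; id)
open import Relation.Binary.PropositionalEquality
open import Relation.Nullary using (yes; no; does; contradiction)
open import Relation.Nullary.Decidable using (from-yes; from-no)
open import Algebra.Definitions.RawSemiring +-*-rawSemiring using (_^_)
open +-*-Solver using (solve; _:=_; _:+_; _:*_; _:-_; :-_; con)

-- Order, division and embedded naturals in the rationals.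

2ℚ : ℚ
2ℚ = 1ℚ + 1ℚ

0≤1ℚ : 0ℚ ≤ 1ℚ
0≤1ℚ = from-yes (0ℚ ≤? 1ℚ)

0≤2ℚ : 0ℚ ≤ 2ℚ
0≤2ℚ = from-yes (0ℚ ≤? 2ℚ)

≤-by-difference : ∀ {p q} r → 0ℚ ≤ r → q ≡ p + r → p ≤ q
≤-by-difference {p} r 0≤r refl = subst (_≤ p + r) (+-identityʳ p) (+-monoʳ-≤ p 0≤r)

0≤q-p : ∀ {p q} → p ≤ q → 0ℚ ≤ q - p
0≤q-p {p} {q} p≤q = subst (_≤ q - p) (+-inverseʳ p) (+-monoˡ-≤ (- p) p≤q)

*-monoˡ : ∀ {r p q} → 0ℚ ≤ r → p ≤ q → p * r ≤ q * r
*-monoˡ {r} 0≤r = *-monoʳ-≤-nonNeg r {{nonNegative 0≤r}}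

*-monoʳ : ∀ {r p q} → 0ℚ ≤ r → p ≤ q → r * p ≤ r * q
*-monoʳ {r} 0≤r = *-monoˡ-≤-nonNeg r {{nonNegative 0≤r}}

*-cancelʳ : ∀ {r p q} → 0ℚ < r → p * r ≤ q * r → p ≤ q
*-cancelʳ {r} 0<r = *-cancelʳ-≤-pos r {{positive 0<r}}

0≤* : ∀ {p q} → 0ℚ ≤ p → 0ℚ ≤ q → 0ℚ ≤ p * q
0≤* {p} {q} 0≤p 0≤q = subst (_≤ p * q) (*-zeroˡ q) (*-monoˡ 0≤q 0≤p)

0≤+ : ∀ {p q} → 0ℚ ≤ p → 0ℚ ≤ q → 0ℚ ≤ p + q
0≤+ 0≤p 0≤q = +-mono-≤ 0≤p 0≤q

0≤^ : ∀ {p} n → 0ℚ ≤ p → 0ℚ ≤ p ^ n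
0≤^ zero 0≤p = 0≤1ℚ
0≤^ (suc n) 0≤p = 0≤* 0≤p (0≤^ n 0≤p)

1^n≡1 : ∀ n → 1ℚ ^ n ≡ 1ℚ
1^n≡1 zero = refl
1^n≡1 (suc n) = trans (*-identityˡ (1ℚ ^ n)) (1^n≡1 n)

0≤p² : ∀ p → 0ℚ ≤ p * p
0≤p² p with ≤-total 0ℚ p
... | inj₁ 0≤p = 0≤* 0≤p 0≤p
... | inj₂ p≤0 = subst (0ℚ ≤_) (solve 1 (λ x → (:- x) :* (:- x) := x :* x) refl p)
                   (0≤* (neg-antimono-≤ p≤0) (neg-antimono-≤ p≤0))

p²≤0⇒p≡0 : ∀ p → p * p ≤ 0ℚ → p ≡ 0ℚ
p²≤0⇒p≡0 p p²≤0 with p ≟ 0ℚ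
... | yes p≡0 = p≡0
-- The equation is derived outright here, from p = p² p⁻¹ + p (1 - p p⁻¹), where both summands
-- vanish.
... | no p≢0 = trans (trans (solve 2 (λ x y → x := (x :* x) :* y :+ x :* (con 1ℚ :- x :* y)) refl p p⁻¹)
                 (cong₂ (λ s t → s * p⁻¹ + p * (1ℚ - t)) (≤-antisym p²≤0 (0≤p² p)) (*-inverseʳ p)))
                 (solve 2 (λ x y → con 0ℚ :* y :+ x :* (con 1ℚ :- con 1ℚ) := con 0ℚ) refl p p⁻¹)
  where
  instance p-nonZero = ≢-nonZero p≢0
  p⁻¹ = 1/ p

-- The case analysis mirrors the numerator match in `/'`. The division is unfolded only here;
-- everything later rests on this cancellation law.
/'-* : ∀ p {q} → 0ℚ < q → (p /' q) * q ≡ p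
/'-* p {mkℚ (ℤ.+ 0) d c} (*<* (ℤ.+<+ ()))
/'-* p {q@(mkℚ +[1+ n ] d c)} 0<q =
  trans (*-assoc p (1/ q) q) (trans (cong (p *_) (*-inverseˡ q)) (*-identityʳ p))
/'-* p {q@(mkℚ -[1+ n ] d c)} 0<q =
  trans (*-assoc p (1/ q) q) (trans (cong (p *_) (*-inverseˡ q)) (*-identityʳ p))

*-cancelʳ-≡ : ∀ {r p q} → 0ℚ < r → p * r ≡ q * r → p ≡ q
*-cancelʳ-≡ 0<r eq = ≤-antisym (*-cancelʳ 0<r (≤-reflexive eq)) (*-cancelʳ 0<r (≤-reflexive (sym eq)))

≤-/' : ∀ {p q r} → 0ℚ < r → p * r ≤ q → p ≤ q /' r
≤-/' {p} {q} {r} 0<r le = *-cancelʳ 0<r (subst (p * r ≤_) (sym (/'-* q 0<r)) le)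

0≤/' : ∀ {p q} → 0ℚ ≤ p → 0ℚ < q → 0ℚ ≤ p /' q
0≤/' {p} {q} 0≤p 0<q = ≤-/' 0<q (subst (_≤ p) (sym (*-zeroˡ q)) 0≤p)

-- Rational fractions are normalised by a gcd, which is stuck on variables; on unnormalised
-- rationals with denominator 1 the equation reduces to integers.
ℕtoℚ-+ : ∀ m n → ℕtoℚ (m ℕ.+ n) ≡ ℕtoℚ m + ℕtoℚ n
ℕtoℚ-+ m n = toℚᵘ-injective (begin-equality
  toℚᵘ (ℕtoℚ (m ℕ.+ n))                       ≃⟨ toℚᵘ-fromℚᵘ (ℚᵘ.mkℚᵘ (ℤ.+ (m ℕ.+ n)) 0) ⟩
  ℚᵘ.mkℚᵘ (ℤ.+ (m ℕ.+ n)) 0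
    ≃⟨ ℚᵘ.*≡* (cong (ℤ._* (ℤ.+ 1)) (sym (cong₂ ℤ._+_ (ℤ.*-identityʳ (ℤ.+ m)) (ℤ.*-identityʳ (ℤ.+ n))))) ⟩
  ℚᵘ.mkℚᵘ (ℤ.+ m) 0 ℚᵘ.+ ℚᵘ.mkℚᵘ (ℤ.+ n) 0
    ≃⟨ ℚᵘ.+-cong (toℚᵘ-fromℚᵘ (ℚᵘ.mkℚᵘ (ℤ.+ m) 0)) (toℚᵘ-fromℚᵘ (ℚᵘ.mkℚᵘ (ℤ.+ n) 0)) ⟨
  toℚᵘ (ℕtoℚ m) ℚᵘ.+ toℚᵘ (ℕtoℚ n)            ≃⟨ toℚᵘ-homo-+ (ℕtoℚ m) (ℕtoℚ n) ⟨
  toℚᵘ (ℕtoℚ m + ℕtoℚ n)                      ∎)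
  where open ℚᵘ.≤-Reasoning

ℕtoℚ-suc : ∀ n → ℕtoℚ (suc n) ≡ 1ℚ + ℕtoℚ n
ℕtoℚ-suc = ℕtoℚ-+ 1

ℕtoℚ-* : ∀ m n → ℕtoℚ (m ℕ.* n) ≡ ℕtoℚ m * ℕtoℚ n
ℕtoℚ-* zero n = sym (*-zeroˡ (ℕtoℚ n))
ℕtoℚ-* (suc m) n = begin
  ℕtoℚ (n ℕ.+ m ℕ.* n)        ≡⟨ ℕtoℚ-+ n (m ℕ.* n) ⟩
  ℕtoℚ n + ℕtoℚ (m ℕ.* n)     ≡⟨ cong (ℕtoℚ n +_) (ℕtoℚ-* m n) ⟩
  ℕtoℚ n + ℕtoℚ m * ℕtoℚ n
    ≡⟨ solve 2 (λ x y → y :+ x :* y := (con 1ℚ :+ x) :* y) refl (ℕtoℚ m) (ℕtoℚ n) ⟩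
  (1ℚ + ℕtoℚ m) * ℕtoℚ n      ≡⟨ cong (_* ℕtoℚ n) (ℕtoℚ-suc m) ⟨
  ℕtoℚ (suc m) * ℕtoℚ n       ∎
  where open ≡-Reasoning

ℕtoℚ-suc-1 : ∀ n → ℕtoℚ (suc n) - 1ℚ ≡ ℕtoℚ n
ℕtoℚ-suc-1 n = trans (cong (_- 1ℚ) (ℕtoℚ-suc n)) (solve 1 (λ x →
  (con 1ℚ :+ x) :- con 1ℚ := x) refl (ℕtoℚ n))

0≤ℕtoℚ : ∀ n → 0ℚ ≤ ℕtoℚ n
0≤ℕtoℚ zero = ≤-refl
0≤ℕtoℚ (suc n) = subst (0ℚ ≤_) (sym (ℕtoℚ-suc n)) (0≤+ 0≤1ℚ (0≤ℕtoℚ n))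

ℕtoℚ-mono-≤ : ∀ {m n} → m ℕ.≤ n → ℕtoℚ m ≤ ℕtoℚ n
ℕtoℚ-mono-≤ {m} {n} m≤n = ≤-by-difference (ℕtoℚ (n ℕ.∸ m)) (0≤ℕtoℚ (n ℕ.∸ m))
  (trans (cong ℕtoℚ (sym (ℕ.m+[n∸m]≡n m≤n))) (ℕtoℚ-+ m (n ℕ.∸ m)))

0<ℕtoℚ : ∀ {n} → 1 ℕ.≤ n → 0ℚ < ℕtoℚ n
0<ℕtoℚ 1≤n = <-≤-trans (from-yes (0ℚ <? 1ℚ)) (ℕtoℚ-mono-≤ 1≤n)

-- Bernoulli's inequality and harmonic sums.

-- Bernoulli's inequality (1 + 1/N)^ℓ ≥ 1 + ℓ/N for 1/q = 1 + 1/N, with denominators cleared.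
q^ℓ*[N+ℓ]≤N : ∀ {q N} ℓ → 0ℚ ≤ q → q ≤ 1ℚ → q * (1ℚ + N) ≡ N → q ^ ℓ * (N + ℕtoℚ ℓ) ≤ N
q^ℓ*[N+ℓ]≤N {q} {N} zero _ _ _ = ≤-reflexive (trans (*-identityˡ (N + 0ℚ)) (+-identityʳ N))
q^ℓ*[N+ℓ]≤N {q} {N} (suc ℓ) 0≤q q≤1 eq =
  ≤-trans (≤-by-difference (q ^ ℓ * ((1ℚ - q) * x)) (0≤* (0≤^ ℓ 0≤q) (0≤* (0≤q-p q≤1) (0≤ℕtoℚ ℓ))) step)
  (q^ℓ*[N+ℓ]≤N ℓ 0≤q q≤1 eq)
  where
  open ≡-Reasoning
  x = ℕtoℚ ℓ
  r = q ^ ℓ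
  step : r * (N + x) ≡ (q * r) * (N + ℕtoℚ (suc ℓ)) + r * ((1ℚ - q) * x)
  step = begin
    r * (N + x)                                    ≡⟨ cong (λ t → r * (t + x)) eq ⟨
    r * (q * (1ℚ + N) + x)
      ≡⟨ solve 4 (λ r q N x → r :* (q :* (con 1ℚ :+ N) :+ x) := (q :* r) :* (N :+ (con 1ℚ :+ x)) :+ r :*
      ((con 1ℚ :- q) :* x)) refl r q N x ⟩
    (q * r) * (N + (1ℚ + x)) + r * ((1ℚ - q) * x)
      ≡⟨ cong (λ t → (q * r) * (N + t) + r * ((1ℚ - q) * x)) (ℕtoℚ-suc ℓ) ⟨
    (q * r) * (N + ℕtoℚ (suc ℓ)) + r * ((1ℚ - q) * x) ∎

-- harmonic n = ∑ 1/i over 2 ≤ i ≤ n + 1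
harmonic : ℕ → ℚ
harmonic zero = 0ℚ
harmonic (suc n) = harmonic n + 1ℚ /' ℕtoℚ (2 ℕ.+ n)

0<2+n : ∀ n → 0ℚ < ℕtoℚ (2 ℕ.+ n)
0<2+n n = 0<ℕtoℚ {2 ℕ.+ n} (s≤s z≤n)

0≤harmonic : ∀ n → 0ℚ ≤ harmonic n
0≤harmonic zero = ≤-refl
0≤harmonic (suc n) = 0≤+ (0≤harmonic n) (0≤/' 0≤1ℚ (0<2+n n))

-- The m summands after the first n have denominators from n + 2 to n + m + 1, hence at most N.
harmonic-block : ∀ n m {N} → n ℕ.+ m ℕ.< N → (harmonic (m ℕ.+ n) - harmonic n) * ℕtoℚ N ≥ ℕtoℚ m
harmonic-block n zero {N} _ =
  ≤-reflexive (solve 2 (λ h N → con 0ℚ := (h :- h) :* N) refl (harmonic n) (ℕtoℚ N))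
harmonic-block n (suc m) {N} lt = subst₂ _≤_ (sym (ℕtoℚ-suc m))
    (solve 4 (λ a b w N → w :* N :+ (a :- b) :* N := ((a :+ w) :- b) :* N) refl (harmonic (m ℕ.+ n))
      (harmonic n) w (ℕtoℚ N))
    (+-mono-≤ 1≤wN (harmonic-block n m (ℕ.<-trans (ℕ.+-monoʳ-< n (ℕ.n<1+n m)) lt)))
  where
  w = 1ℚ /' ℕtoℚ (2 ℕ.+ (m ℕ.+ n))
  le : 2 ℕ.+ (m ℕ.+ n) ℕ.≤ N
  le = subst (λ t → suc t ℕ.≤ N) (trans (ℕ.+-suc n m) (cong suc (ℕ.+-comm n m))) lt
  1≤wN : 1ℚ ≤ w * ℕtoℚ N
  1≤wN = subst (_≤ w * ℕtoℚ N) (/'-* 1ℚ (0<2+n (m ℕ.+ n)))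
           (*-monoʳ (0≤/' 0≤1ℚ (0<2+n (m ℕ.+ n))) (ℕtoℚ-mono-≤ le))

-- The terms with indices between k/2 and k contribute at least 1/2 to the sum, and halving k
-- lowers ⌊log₂ k⌋ by one.
log≤1+2harmonic : ∀ n → ℕtoℚ ⌊log₂ (2 ℕ.+ n) ⌋ ≤ 1ℚ + 2ℚ * harmonic n
log≤1+2harmonic = <-rec _ go
  where
  base : ∀ n → 1ℚ ≤ 1ℚ + 2ℚ * harmonic n
  base n = ≤-by-difference (2ℚ * harmonic n) (0≤* 0≤2ℚ (0≤harmonic n)) refl
  go : ∀ n → (∀ {i} → i ℕ.< n → ℕtoℚ ⌊log₂ (2 ℕ.+ i) ⌋ ≤ 1ℚ + 2ℚ * harmonic i) →
       ℕtoℚ ⌊log₂ (2 ℕ.+ n) ⌋ ≤ 1ℚ + 2ℚ * harmonic n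
  go 0 ih = base 0
  go 1 ih = base 1
  go (suc (suc n)) ih = begin
    ℕtoℚ ⌊log₂ (4 ℕ.+ n) ⌋               ≤⟨ ℕtoℚ-mono-≤ log≤ ⟩
    ℕtoℚ (suc ⌊log₂ (2 ℕ.+ i) ⌋)         ≡⟨ ℕtoℚ-suc ⌊log₂ (2 ℕ.+ i) ⌋ ⟩
    1ℚ + ℕtoℚ ⌊log₂ (2 ℕ.+ i) ⌋          ≤⟨ +-monoʳ-≤ 1ℚ (ih i<) ⟩
    1ℚ + (1ℚ + 2ℚ * harmonic i)
      ≤⟨ ≤-by-difference (2ℚ * (h - harmonic i) - 1ℚ) (0≤q-p half) (solve 2 (λ h a →
      con 1ℚ :+ con 2ℚ :* h := (con 1ℚ :+ (con 1ℚ :+ con 2ℚ :* a)) :+ (con 2ℚ :* (h :- a) :- con 1ℚ))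
      refl h (harmonic i)) ⟩
    1ℚ + 2ℚ * h                          ∎
    where
    open ≤-Reasoning
    -- Half of 4 + n is 2 + `i`. Between `harmonic i` and `h` lie the `j` terms 1/(i + 2), ..., 1/(n
    -- + 3), each at least 1/`N`, and `N` ≤ 2`j`.
    i = ℕ.⌊ n /2⌋
    h = harmonic (2 ℕ.+ n)
    j = 2 ℕ.+ ℕ.⌈ n /2⌉
    N = 3 ℕ.+ n
    log≤ : ⌊log₂ (4 ℕ.+ n) ⌋ ℕ.≤ suc ⌊log₂ (2 ℕ.+ i) ⌋
    log≤ = ℕ.≤-trans (ℕ.m≤n+m∸n ⌊log₂ (4 ℕ.+ n) ⌋ 1)
      (ℕ.≤-reflexive (cong suc (sym (⌊log₂⌊n/2⌋⌋≡⌊log₂n⌋∸1 (4 ℕ.+ n)))))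
    i< : i ℕ.< 2 ℕ.+ n
    i< = s≤s (ℕ.m≤n⇒m≤1+n (ℕ.⌊n/2⌋≤n n))
    j+i≡2+n : j ℕ.+ i ≡ 2 ℕ.+ n
    j+i≡2+n = cong (2 ℕ.+_) (trans (ℕ.+-comm ℕ.⌈ n /2⌉ i) (ℕ.⌊n/2⌋+⌈n/2⌉≡n n))
    N≤2j : N ℕ.≤ j ℕ.+ j
    N≤2j = ℕ.≤-trans (ℕ.≤-reflexive (cong suc (sym j+i≡2+n)))
      (ℕ.≤-trans (ℕ.≤-reflexive (sym (ℕ.+-suc j i)))
             (ℕ.+-monoʳ-≤ j (ℕ.m≤n⇒m≤1+n (s≤s (ℕ.⌊n/2⌋≤⌈n/2⌉ n)))))
    block : ℕtoℚ j ≤ (h - harmonic i) * ℕtoℚ N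
    block = subst (λ t → ℕtoℚ j ≤ (harmonic t - harmonic i) * ℕtoℚ N) j+i≡2+n
              (harmonic-block i j (s≤s (ℕ.≤-reflexive (trans (ℕ.+-comm i j) j+i≡2+n))))
    half : 1ℚ ≤ 2ℚ * (h - harmonic i)
    half = *-cancelʳ (0<ℕtoℚ {N} (s≤s z≤n)) (begin
      1ℚ * ℕtoℚ N                                                      ≡⟨ *-identityˡ (ℕtoℚ N) ⟩
      ℕtoℚ N                                                           ≤⟨ ℕtoℚ-mono-≤ N≤2j ⟩
      ℕtoℚ (j ℕ.+ j)                                                   ≡⟨ ℕtoℚ-+ j j ⟩
      ℕtoℚ j + ℕtoℚ j                                                  ≤⟨ +-mono-≤ block block ⟩
      (h - harmonic i) * ℕtoℚ N + (h - harmonic i) * ℕtoℚ N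
        ≡⟨ solve 2 (λ d N → d :* N :+ d :* N := (con 2ℚ :* d) :* N) refl (h - harmonic i) (ℕtoℚ N) ⟩
      (2ℚ * (h - harmonic i)) * ℕtoℚ N                                 ∎)

-- Finite sums and products, and sums over sample sequences.

0≤sumℚ : ∀ {A : Set} {f : A → ℚ} → (∀ x → 0ℚ ≤ f x) → ∀ xs → 0ℚ ≤ sumℚ (map f xs)
0≤sumℚ 0≤f [] = ≤-refl
0≤sumℚ 0≤f (x ∷ xs) = 0≤+ (0≤f x) (0≤sumℚ 0≤f xs)

0≤prodℚ : ∀ {A : Set} {f : A → ℚ} → (∀ x → 0ℚ ≤ f x) → ∀ xs → 0ℚ ≤ prodℚ (map f xs)
0≤prodℚ 0≤f [] = 0≤1ℚ
0≤prodℚ 0≤f (x ∷ xs) = 0≤* (0≤f x) (0≤prodℚ 0≤f xs)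

sumℚ-mono : ∀ {A : Set} {f g : A → ℚ} → (∀ x → f x ≤ g x) → ∀ xs → sumℚ (map f xs) ≤ sumℚ (map g xs)
sumℚ-mono f≤g [] = ≤-refl
sumℚ-mono f≤g (x ∷ xs) = +-mono-≤ (f≤g x) (sumℚ-mono f≤g xs)

sumℚ-*ˡ : ∀ {A : Set} a (f : A → ℚ) xs → sumℚ (map (λ x → a * f x) xs) ≡ a * sumℚ (map f xs)
sumℚ-*ˡ a f [] = sym (*-zeroʳ a)
sumℚ-*ˡ a f (x ∷ xs) = trans (cong (a * f x +_) (sumℚ-*ˡ a f xs))
  (sym (*-distribˡ-+ a (f x) (sumℚ (map f xs))))

sumℚ-*ʳ : ∀ {A : Set} a (f : A → ℚ) xs → sumℚ (map (λ x → f x * a) xs) ≡ sumℚ (map f xs) * a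
sumℚ-*ʳ a f [] = sym (*-zeroˡ a)
sumℚ-*ʳ a f (x ∷ xs) = trans (cong (f x * a +_) (sumℚ-*ʳ a f xs))
  (sym (*-distribʳ-+ a (f x) (sumℚ (map f xs))))

sumℚ-- : ∀ {A : Set} (f g : A → ℚ) xs →
  sumℚ (map (λ x → f x - g x) xs) ≡ sumℚ (map f xs) - sumℚ (map g xs)
sumℚ-- f g [] = refl
sumℚ-- f g (x ∷ xs) = trans (cong (f x - g x +_) (sumℚ-- f g xs))
  (solve 4 (λ a b c d → (a :- b) :+ (c :- d) := (a :+ c) :- (b :+ d)) refl (f x) (g x) (sumℚ (map f xs))
    (sumℚ (map g xs)))

sumℚ-const : ∀ {A : Set} a (xs : List A) → sumℚ (map (λ _ → a) xs) ≡ a * ℕtoℚ (length xs)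
sumℚ-const a [] = sym (*-zeroʳ a)
sumℚ-const a (x ∷ xs) = begin
  a + sumℚ (map (λ _ → a) xs)  ≡⟨ cong (a +_) (sumℚ-const a xs) ⟩
  a + a * ℕtoℚ (length xs)
    ≡⟨ solve 2 (λ a n → a :+ a :* n := a :* (con 1ℚ :+ n)) refl a (ℕtoℚ (length xs)) ⟩
  a * (1ℚ + ℕtoℚ (length xs))  ≡⟨ cong (a *_) (ℕtoℚ-suc (length xs)) ⟨
  a * ℕtoℚ (suc (length xs))   ∎
  where open ≡-Reasoning

sumℚ-++ : ∀ xs ys → sumℚ (xs ++ ys) ≡ sumℚ xs + sumℚ ys
sumℚ-++ [] ys = sym (+-identityˡ (sumℚ ys))
sumℚ-++ (x ∷ xs) ys = trans (cong (x +_) (sumℚ-++ xs ys)) (sym (+-assoc x (sumℚ xs) (sumℚ ys)))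

∈⇒≤sumℚ : ∀ {A : Set} {f : A → ℚ} → (∀ x → 0ℚ ≤ f x) → ∀ {x xs} → x ∈ xs → f x ≤ sumℚ (map f xs)
∈⇒≤sumℚ {f = f} 0≤f {xs = x ∷ xs} (here refl) = ≤-by-difference (sumℚ (map f xs)) (0≤sumℚ 0≤f xs) refl
∈⇒≤sumℚ {f = f} 0≤f {x} {y ∷ xs} (there x∈xs) = ≤-trans (∈⇒≤sumℚ 0≤f x∈xs)
  (≤-by-difference (f y) (0≤f y) (+-comm (f y) (sumℚ (map f xs))))

sumℚ-concatMap : ∀ {A B : Set} (f : B → ℚ) (g : A → List B) xs →
  sumℚ (map f (concatMap g xs)) ≡ sumℚ (map (λ x → sumℚ (map f (g x))) xs)
sumℚ-concatMap f g [] = refl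
sumℚ-concatMap f g (x ∷ xs) = begin
  sumℚ (map f (g x ++ concatMap g xs))
    ≡⟨ cong sumℚ (map-++ f (g x) (concatMap g xs)) ⟩
  sumℚ (map f (g x) ++ map f (concatMap g xs))
    ≡⟨ sumℚ-++ (map f (g x)) (map f (concatMap g xs)) ⟩
  sumℚ (map f (g x)) + sumℚ (map f (concatMap g xs))
    ≡⟨ cong (sumℚ (map f (g x)) +_) (sumℚ-concatMap f g xs) ⟩
  sumℚ (map f (g x)) + sumℚ (map (λ x → sumℚ (map f (g x))) xs) ∎
  where open ≡-Reasoning

prodℚ-* : ∀ {A : Set} (f g : A → ℚ) xs →
  prodℚ (map (λ x → f x * g x) xs) ≡ prodℚ (map f xs) * prodℚ (map g xs)
prodℚ-* f g [] = refl
prodℚ-* f g (x ∷ xs) = trans (cong (f x * g x *_) (prodℚ-* f g xs))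
  (solve 4 (λ a b c d → (a :* b) :* (c :* d) := (a :* c) :* (b :* d)) refl (f x) (g x) (prodℚ (map f xs))
    (prodℚ (map g xs)))

sumℚ-seqs-suc : ∀ {A : Set} (F : List A → ℚ) l xs →
  sumℚ (map F (seqs (suc l) xs)) ≡ sumℚ (map (λ x → sumℚ (map (λ S → F (x ∷ S)) (seqs l xs))) xs)
sumℚ-seqs-suc F l xs = trans (sumℚ-concatMap F (λ x → map (x ∷_) (seqs l xs)) xs)
  (cong sumℚ (map-cong (λ x → cong sumℚ (sym (map-∘ (seqs l xs)))) xs))

-- Sequences of positive length are nonempty, so the degenerate empty-sample clause of the greedy
-- step never has to be compared.
sumℚ-seqs-mono : ∀ {A : Set} {F G : List A → ℚ} l xs → (∀ x S → F (x ∷ S) ≤ G (x ∷ S)) →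
  sumℚ (map F (seqs (suc l) xs)) ≤ sumℚ (map G (seqs (suc l) xs))
sumℚ-seqs-mono {F = F} {G} l xs F≤G =
  subst₂ _≤_ (sym (sumℚ-seqs-suc F l xs)) (sym (sumℚ-seqs-suc G l xs))
  (sumℚ-mono (λ x → sumℚ-mono (F≤G x) (seqs l xs)) xs)

-- Independence of the samples, by distributivity. With `f` the sampling distribution it gives total
-- mass 1; with the origin's mass deleted, the probability that all samples miss it.
sumℚ-seqs-prodℚ : ∀ {A : Set} (f : A → ℚ) l xs →
  sumℚ (map (λ S → prodℚ (map f S)) (seqs l xs)) ≡ sumℚ (map f xs) ^ l
sumℚ-seqs-prodℚ f zero xs = refl
sumℚ-seqs-prodℚ f (suc l) xs = begin
  sumℚ (map (λ S → prodℚ (map f S)) (seqs (suc l) xs))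
    ≡⟨ sumℚ-seqs-suc (λ S → prodℚ (map f S)) l xs ⟩
  sumℚ (map (λ x → sumℚ (map (λ S → f x * prodℚ (map f S)) (seqs l xs))) xs)
    ≡⟨ cong sumℚ (map-cong (λ x →
    trans (sumℚ-*ˡ (f x) (λ S → prodℚ (map f S)) (seqs l xs)) (cong (f x *_) (sumℚ-seqs-prodℚ f l xs)))
    xs) ⟩
  sumℚ (map (λ x → f x * sumℚ (map f xs) ^ l) xs)
    ≡⟨ sumℚ-*ʳ (sumℚ (map f xs) ^ l) f xs ⟩
  sumℚ (map f xs) * sumℚ (map f xs) ^ l                                     ∎
  where open ≡-Reasoning

-- Transfers the sum over samples of points to samples of labels.
seqs-map : ∀ {A B : Set} (f : A → B) l xs → seqs l (map f xs) ≡ map (map f) (seqs l xs)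
seqs-map f zero xs = refl
seqs-map f (suc l) xs = go xs
  where
  open ≡-Reasoning
  go : ∀ ys → concatMap (λ x → map (x ∷_) (seqs l (map f xs))) (map f ys) ≡
              map (map f) (concatMap (λ x → map (x ∷_) (seqs l xs)) ys)
  go [] = refl
  go (y ∷ ys) = begin
    map (f y ∷_) (seqs l (map f xs)) ++ _
      ≡⟨ cong₂ _++_ (trans (cong (map (f y ∷_)) (seqs-map f l xs))
      (trans (sym (map-∘ (seqs l xs))) (map-∘ (seqs l xs)))) (go ys) ⟩
    map (map f) (map (y ∷_) (seqs l xs)) ++ map (map f) (concatMap (λ x → map (x ∷_) (seqs l xs)) ys)
      ≡⟨ map-++ (map f) (map (y ∷_) (seqs l xs)) _ ⟨
    map (map f) (map (y ∷_) (seqs l xs) ++ concatMap (λ x → map (x ∷_) (seqs l xs)) ys) ∎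

-- Squared distances and clustering costs.

0≤dist² : ∀ {d} (x y : Point d) → 0ℚ ≤ dist² x y
0≤dist² Vec.[] Vec.[] = ≤-refl
0≤dist² (a Vec.∷ x) (b Vec.∷ y) = 0≤+ (0≤p² (a - b)) (0≤dist² x y)

≤costTo : ∀ {d t} (x : Point d) c C → (∀ {c'} → c' ∈ c ∷ C → t ≤ dist² x c') → t ≤ costTo x (c ∷ C)
≤costTo x c [] t≤ = t≤ (here refl)
≤costTo x c (c' ∷ C) t≤ = ⊓-glb (t≤ (here refl)) (≤costTo x c' C (t≤ ∘ there))

costTo≤ : ∀ {d} {x c : Point d} {C} → c ∈ C → costTo x C ≤ dist² x c
costTo≤ {C = c ∷ []} (here refl) = ≤-refl
costTo≤ {x = x} {C = c ∷ c' ∷ C} (here refl) = p⊓q≤p (dist² x c) (costTo x (c' ∷ C))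
costTo≤ {x = x} {C = c ∷ c' ∷ C} (there c∈C) =
  ≤-trans (p⊓q≤q (dist² x c) (costTo x (c' ∷ C))) (costTo≤ c∈C)

costTo-attained : ∀ {d} (x : Point d) c C → ∃ λ c' → c' ∈ c ∷ C × costTo x (c ∷ C) ≡ dist² x c'
costTo-attained x c [] = c , here refl , refl
costTo-attained x c (c' ∷ C) with ⊓-sel (dist² x c) (costTo x (c' ∷ C)) | costTo-attained x c' C
... | inj₁ eq | _ = c , here refl , eq
... | inj₂ eq | c″ , c″∈ , eq′ = c″ , there c″∈ , trans eq eq′

0≤costTo : ∀ {d} (x : Point d) C → 0ℚ ≤ costTo x C
0≤costTo x [] = ≤-refl
0≤costTo x (c ∷ C) = ≤costTo x c C (λ {c'} _ → 0≤dist² x c')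

0≤Φ : ∀ {d} (X C : List (Point d)) → 0ℚ ≤ Φ X C
0≤Φ X C = 0≤sumℚ (λ x → 0≤costTo x C) X

-- Lower bounds for a single greedy step.

≤ᵇ-true : ∀ {p q} → p ≤ q → (p ≤ᵇ q) ≡ true
≤ᵇ-true {p} {q} p≤q with p ≤ᵇ q | ≤⇒≤ᵇ p≤q
... | true | _ = refl

≤ᵇ-false : ∀ {p q} → q < p → (p ≤ᵇ q) ≡ false
≤ᵇ-false {p} {q} q<p with p ≤ᵇ q | ≤ᵇ⇒≤ {p} {q}
... | false | _ = refl
... | true | p≤q = ⊥-elim (<-irrefl refl (<-≤-trans q<p (p≤q tt)))

if-false : ∀ {A : Set} {b} {x y : A} → b ≡ false → (if b then x else y) ≡ y
if-false refl = refl

-- The points are the images of labels, so that a sample is a list of labels. The bound is the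
-- expectation of a - b ∏ χ over the sample, which factorises by independence.
greedyExp-step : ∀ {d} {A : Set} (pt : A → Point d) (as : List A) l m C (χ : A → ℚ) a b →
  0ℚ < Φ (map pt as) C →
  (∀ t T → a - b * prodℚ (map χ (t ∷ T)) ≤
           greedyExp (suc l) (map pt as) m (bestFrom (map pt as) C (pt t) (map pt T) ∷ C)) →
  a - b * sumℚ (map (λ t → χ t * (costTo (pt t) C /' Φ (map pt as) C)) as) ^ suc l ≤
    greedyExp (suc l) (map pt as) (suc m) C
greedyExp-step pt as l m C χ a b 0<Φ hyp =
  subst (a - b * sumℚ (map χp as) ^ suc l ≤_) (sym (if-false {b = Φ X C ≤ᵇ 0ℚ} (≤ᵇ-false 0<Φ)))
   (subst (a - b * sumℚ (map χp as) ^ suc l ≤_) (cong (sumℚ ∘ map _) (sym (seqs-map pt (suc l) as)))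
    (subst (a - b * sumℚ (map χp as) ^ suc l ≤_) (cong sumℚ (map-∘ (seqs (suc l) as)))
      (subst (_≤ _) total (sumℚ-seqs-mono l as pointwise))))
  where
  X = map pt as
  p χp : _ → ℚ
  p t = costTo (pt t) C /' Φ X C
  χp t = χ t * p t
  lower : _ → ℚ
  lower T = a * prodℚ (map p T) - b * prodℚ (map χp T)
  ∑p≡1 : sumℚ (map p as) ≡ 1ℚ
  ∑p≡1 = *-cancelʳ-≡ 0<Φ (begin
    sumℚ (map p as) * Φ X C                      ≡⟨ sumℚ-*ʳ (Φ X C) p as ⟨
    sumℚ (map (λ t → p t * Φ X C) as)
      ≡⟨ cong sumℚ (map-cong (λ t → /'-* (costTo (pt t) C) 0<Φ) as) ⟩
    sumℚ (map (λ t → costTo (pt t) C) as)        ≡⟨ cong sumℚ (map-∘ as) ⟩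
    Φ X C                                        ≡⟨ *-identityˡ (Φ X C) ⟨
    1ℚ * Φ X C                                   ∎)
    where open ≡-Reasoning
  total : sumℚ (map lower (seqs (suc l) as)) ≡ a - b * sumℚ (map χp as) ^ suc l
  total = begin
    sumℚ (map lower (seqs (suc l) as))
      ≡⟨ sumℚ-- (λ T → a * prodℚ (map p T)) (λ T → b * prodℚ (map χp T)) (seqs (suc l) as) ⟩
    sumℚ (map (λ T → a * prodℚ (map p T)) (seqs (suc l) as)) -
    sumℚ (map (λ T → b * prodℚ (map χp T)) (seqs (suc l) as))
      ≡⟨ cong₂ _-_ (∑∏ a p) (∑∏ b χp) ⟩
    a * sumℚ (map p as) ^ suc l - b * sumℚ (map χp as) ^ suc l
      ≡⟨ cong (_- b * sumℚ (map χp as) ^ suc l)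
        (trans (cong (λ s → a * s ^ suc l) ∑p≡1) (trans (cong (a *_) (1^n≡1 (suc l))) (*-identityʳ a))) ⟩
    a - b * sumℚ (map χp as) ^ suc l ∎
    where
    open ≡-Reasoning
    ∑∏ : ∀ c f → sumℚ (map (λ T → c * prodℚ (map f T)) (seqs (suc l) as)) ≡ c * sumℚ (map f as) ^ suc l
    ∑∏ c f = trans (sumℚ-*ˡ c (λ T → prodℚ (map f T)) (seqs (suc l) as))
      (cong (c *_) (sumℚ-seqs-prodℚ f (suc l) as))
  next : _ → _ → ℚ
  next t T = greedyExp (suc l) X m (bestFrom X C (pt t) (map pt T) ∷ C)
  pointwise : ∀ t T → lower (t ∷ T) ≤ prodℚ (map (λ s → costTo s C /' Φ X C) (map pt (t ∷ T))) * next t T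
  pointwise t T = subst₂ _≤_
    (trans (solve 4 (λ P a b x →
      P :* (a :- b :* x) := a :* P :- b :* (x :* P)) refl (prodℚ (map p (t ∷ T))) a b
      (prodℚ (map χ (t ∷ T))))
           (cong (λ s → a * prodℚ (map p (t ∷ T)) - b * s) (sym (prodℚ-* χ p (t ∷ T)))))
    (cong (λ s → prodℚ s * next t T) (map-∘ {g = λ s → costTo s C /' Φ X C} {f = pt} (t ∷ T)))
    (*-monoʳ (0≤prodℚ (λ s → 0≤/' (0≤costTo (pt s) C) 0<Φ) (t ∷ T)) (hyp t T))

-- The case b = 0: a bound valid after every sample is valid in expectation.
greedyExp-step-≥ : ∀ {d} {A : Set} (pt : A → Point d) (as : List A) l m C a →
  0ℚ < Φ (map pt as) C →
  (∀ t T → a ≤ greedyExp (suc l) (map pt as) m (bestFrom (map pt as) C (pt t) (map pt T) ∷ C)) →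
  a ≤ greedyExp (suc l) (map pt as) (suc m) C
greedyExp-step-≥ pt as l m C a 0<Φ hyp = subst (_≤ greedyExp (suc l) (map pt as) (suc m) C)
  (a-0*x≡a (sumℚ (map (λ t → 1ℚ * (costTo (pt t) C /' Φ (map pt as) C)) as) ^ suc l))
  (greedyExp-step pt as l m C (λ _ → 1ℚ) a 0ℚ 0<Φ λ t T →
    subst (_≤ greedyExp (suc l) (map pt as) m (bestFrom (map pt as) C (pt t) (map pt T) ∷ C))
      (sym (a-0*x≡a (prodℚ (map (λ _ → 1ℚ) (t ∷ T))))) (hyp t T))
  where
  a-0*x≡a : ∀ x → a - 0ℚ * x ≡ a
  a-0*x≡a = solve 2 (λ a x → a :- con 0ℚ :* x := a) refl a

-- Keeps every new center a labelled point, so that states of the run can be described by lists of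
-- labels.
bestFrom-label : ∀ {d} {A : Set} (pt : A → Point d) X C t T → ∃ λ w →
  bestFrom X C (pt t) (map pt T) ≡ pt w
bestFrom-label pt X C t [] = t , refl
bestFrom-label pt X C t (v ∷ T) with Φ X (pt t ∷ C) ≤ᵇ Φ X (pt v ∷ C)
... | true = bestFrom-label pt X C t T
... | false = bestFrom-label pt X C v T

-- Strictness settles ties: only repetitions of `t₀` tie with it, and these are the same point. A
-- scan that holds `t₀` therefore never leaves it for another point, and one that meets it later
-- switches to it.
bestFrom-strict-minimiser : ∀ {d} {A : Set} (pt : A → Point d) X C t₀ →
  (∀ v → v ≡ t₀ ⊎ Φ X (pt t₀ ∷ C) < Φ X (pt v ∷ C)) →
  ∀ t T → t₀ ∈ t ∷ T → bestFrom X C (pt t) (map pt T) ≡ pt t₀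
bestFrom-strict-minimiser pt X C t₀ min = go
  where
  minimal : ∀ v → Φ X (pt t₀ ∷ C) ≤ Φ X (pt v ∷ C)
  minimal v with min v
  ... | inj₁ refl = ≤-refl
  ... | inj₂ lt = <⇒≤ lt
  go : ∀ t T → t₀ ∈ t ∷ T → bestFrom X C (pt t) (map pt T) ≡ pt t₀
  go t [] (here refl) = refl
  go t (v ∷ T) (here refl) rewrite ≤ᵇ-true (minimal v) = go t T (here refl)
  go t (v ∷ T) (there (here refl)) with min t
  ... | inj₁ refl rewrite ≤ᵇ-true (minimal v) = go t T (here refl)
  ... | inj₂ lt rewrite ≤ᵇ-false lt = go v T (here refl)
  go t (v ∷ T) (there (there t₀∈T)) with Φ X (pt t ∷ C) ≤ᵇ Φ X (pt v ∷ C)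
  ... | true = go t T (there t₀∈T)
  ... | false = go v T (there t₀∈T)

-- The instance: the origin and repeated unit vectors.

origin : ∀ {k} → Point k
origin = Vec.replicate _ 0ℚ

unit : ∀ {k} → Fin k → Point k
unit zero = 1ℚ Vec.∷ origin
unit (suc i) = 0ℚ Vec.∷ unit i

pt : ∀ {k} → Fin (suc k) → Point k
pt zero = origin
pt (suc i) = unit i

dist²-refl : ∀ {d} (x : Point d) → dist² x x ≡ 0ℚ
dist²-refl Vec.[] = refl
dist²-refl (a Vec.∷ x) = trans (cong ((a - a) * (a - a) +_) (dist²-refl x)) (solve 1 (λ a →
  (a :- a) :* (a :- a) :+ con 0ℚ := con 0ℚ) refl a)

dist²≤0⇒≡ : ∀ {d} (x y : Point d) → dist² x y ≤ 0ℚ → x ≡ y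
dist²≤0⇒≡ Vec.[] Vec.[] _ = refl
dist²≤0⇒≡ (a Vec.∷ x) (b Vec.∷ y) le = cong₂ Vec._∷_
  (trans (solve 2 (λ a b → a := b :+ (a :- b)) refl a b)
    (trans (cong (b +_) (p²≤0⇒p≡0 (a - b) (≤-trans (≤-by-difference (dist² x y) (0≤dist² x y) refl) le)))
      (+-identityʳ b)))
  (dist²≤0⇒≡ x y (≤-trans (≤-by-difference ((a - b) * (a - b)) (0≤p² (a - b))
    (+-comm ((a - b) * (a - b)) (dist² x y))) le))

dist²-origin-unit : ∀ {k} (i : Fin k) → dist² origin (unit i) ≡ 1ℚ
dist²-origin-unit {suc k} zero = cong (1ℚ +_) (dist²-refl (origin {k}))
dist²-origin-unit (suc i) = cong (0ℚ +_) (dist²-origin-unit i)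

dist²-unit-origin : ∀ {k} (i : Fin k) → dist² (unit i) origin ≡ 1ℚ
dist²-unit-origin {suc k} zero = cong (1ℚ +_) (dist²-refl (origin {k}))
dist²-unit-origin (suc i) = cong (0ℚ +_) (dist²-unit-origin i)

dist²-unit-unit : ∀ {k} {i j : Fin k} → i ≢ j → dist² (unit i) (unit j) ≡ 2ℚ
dist²-unit-unit {i = zero} {zero} i≢j = contradiction refl i≢j
dist²-unit-unit {i = zero} {suc j} _ = cong (1ℚ +_) (dist²-origin-unit j)
dist²-unit-unit {i = suc i} {zero} _ = cong (1ℚ +_) (dist²-unit-origin i)
dist²-unit-unit {i = suc i} {suc j} i≢j = cong (0ℚ +_) (dist²-unit-unit (i≢j ∘ cong suc))

1≤dist² : ∀ {k} (a b : Fin (suc k)) → a ≢ b → 1ℚ ≤ dist² (pt a) (pt b)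
1≤dist² zero zero a≢b = contradiction refl a≢b
1≤dist² zero (suc j) _ = ≤-reflexive (sym (dist²-origin-unit j))
1≤dist² (suc i) zero _ = ≤-reflexive (sym (dist²-unit-origin i))
1≤dist² (suc i) (suc j) a≢b =
  subst (1ℚ ≤_) (sym (dist²-unit-unit (a≢b ∘ cong suc))) (from-yes (1ℚ ≤? 2ℚ))

-- The label zero stands for the origin, suc i for the i-th unit vector.
labels : ∀ k → ℕ → List (Fin (suc k))
labels k M = zero ∷ concatMap (λ i → replicate M (suc i)) (allFin k)

points : ∀ k → ℕ → List (Point k)
points k M = map pt (labels k M)

∑ : ∀ {k} → (Fin k → ℚ) → ℚ
∑ {k} f = sumℚ (map f (allFin k))

∑-single : ∀ {k} (f : Fin k → ℚ) j → (∀ i → i ≢ j → f i ≡ 0ℚ) → ∑ f ≡ f j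
∑-single f j f≡0 = trans (cong sumℚ (map-tabulate id f)) (single f j f≡0)
  where
  none : ∀ {k} (f : Fin k → ℚ) → (∀ i → f i ≡ 0ℚ) → sumℚ (tabulate f) ≡ 0ℚ
  none {zero} f f≡0 = refl
  none {suc k} f f≡0 = cong₂ _+_ (f≡0 zero) (none (f ∘ suc) (f≡0 ∘ suc))
  single : ∀ {k} (f : Fin k → ℚ) j → (∀ i → i ≢ j → f i ≡ 0ℚ) → sumℚ (tabulate f) ≡ f j
  single f zero f≡0 = trans (cong (f zero +_) (none (f ∘ suc) (λ i → f≡0 (suc i) (λ ()))))
    (+-identityʳ (f zero))
  single f (suc j) f≡0 = trans
    (cong₂ _+_ (f≡0 zero (λ ())) (single (f ∘ suc) j (λ i i≢j → f≡0 (suc i) (i≢j ∘ Fin.suc-injective))))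
    (+-identityˡ (f (suc j)))

sumℚ-labels : ∀ k M (f : Fin (suc k) → ℚ) → sumℚ (map f (labels k M)) ≡ f zero + ℕtoℚ M * ∑ (f ∘ suc)
sumℚ-labels k M f = cong (f zero +_) (begin
  sumℚ (map f (concatMap (λ i → replicate M (suc i)) (allFin k)))
    ≡⟨ sumℚ-concatMap f (λ i → replicate M (suc i)) (allFin k) ⟩
  ∑ {k} (λ i → sumℚ (map f (replicate M (suc i))))
    ≡⟨ cong sumℚ (map-cong (λ i → copies M (suc i)) (allFin k)) ⟩
  ∑ {k} (λ i → ℕtoℚ M * f (suc i))
    ≡⟨ sumℚ-*ˡ (ℕtoℚ M) (f ∘ suc) (allFin k) ⟩
  ℕtoℚ M * ∑ (f ∘ suc)                                             ∎)
  where
  open ≡-Reasoning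
  copies : ∀ n a → sumℚ (map f (replicate n a)) ≡ ℕtoℚ n * f a
  copies zero a = sym (*-zeroˡ (f a))
  copies (suc n) a = begin
    f a + sumℚ (map f (replicate n a))   ≡⟨ cong (f a +_) (copies n a) ⟩
    f a + ℕtoℚ n * f a
      ≡⟨ solve 2 (λ x n → x :+ n :* x := (con 1ℚ :+ n) :* x) refl (f a) (ℕtoℚ n) ⟩
    (1ℚ + ℕtoℚ n) * f a                  ≡⟨ cong (_* f a) (ℕtoℚ-suc n) ⟨
    ℕtoℚ (suc n) * f a                   ∎

-- Costs in terms of the number of uncovered unit vectors.

Φ-instance : ∀ k M C → Φ (points k M) C ≡ costTo origin C + ℕtoℚ M * ∑ (λ i → costTo (unit i) C)
Φ-instance k M C = trans (cong sumℚ (sym (map-∘ {g = λ x → costTo x C} {f = pt} (labels k M))))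
  (sumℚ-labels k M (λ a → costTo (pt a) C))

-- A rational indicator rather than a boolean, so that its sum counts the uncovered unit vectors
-- directly inside cost formulas.
miss : ∀ {k} → List (Fin (suc k)) → Fin k → ℚ
miss cs i = if does (_∈?_ Fin._≟_ (suc i) cs) then 0ℚ else 1ℚ

miss-cases : ∀ {k} cs (i : Fin k) → (suc i ∈ cs × miss cs i ≡ 0ℚ) ⊎ (suc i ∉ cs × miss cs i ≡ 1ℚ)
miss-cases cs i with _∈?_ Fin._≟_ (suc i) cs
... | yes i∈cs = inj₁ (i∈cs , refl)
... | no i∉cs = inj₂ (i∉cs , refl)

miss-∈ : ∀ {k} {cs} {i : Fin k} → suc i ∈ cs → miss cs i ≡ 0ℚ
miss-∈ {cs = cs} {i} i∈cs with miss-cases cs i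
... | inj₁ (_ , eq) = eq
... | inj₂ (i∉cs , _) = contradiction i∈cs i∉cs

miss-∉ : ∀ {k} {cs} {i : Fin k} → suc i ∉ cs → miss cs i ≡ 1ℚ
miss-∉ {cs = cs} {i} i∉cs with miss-cases cs i
... | inj₁ (i∈cs , _) = contradiction i∈cs i∉cs
... | inj₂ (_ , eq) = eq

uncovered : ∀ {k} → List (Fin (suc k)) → ℚ
uncovered cs = ∑ (miss cs)

-- Only the summand at `j` changes, so the sum of differences collapses to one term. Subtracting
-- `miss cs j` treats new and repeated centers alike.
uncovered-suc : ∀ {k} j (cs : List (Fin (suc k))) → uncovered (suc j ∷ cs) ≡ uncovered cs - miss cs j
uncovered-suc {k} j cs = begin
  uncovered (suc j ∷ cs)
    ≡⟨ solve 2 (λ u v → v := u :- (u :- v)) refl (uncovered cs) (uncovered (suc j ∷ cs)) ⟩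
  uncovered cs - (uncovered cs - uncovered (suc j ∷ cs))
    ≡⟨ cong (λ t → uncovered cs - t) (sumℚ-- (miss cs) (miss (suc j ∷ cs)) (allFin k)) ⟨
  uncovered cs - ∑ (λ i → miss cs i - miss (suc j ∷ cs) i)
    ≡⟨ cong (λ t → uncovered cs - t) (∑-single (λ i → miss cs i - miss (suc j ∷ cs) i) j others) ⟩
  uncovered cs - (miss cs j - miss (suc j ∷ cs) j)
    ≡⟨ cong (λ t → uncovered cs - (miss cs j - t)) (miss-∈ {cs = suc j ∷ cs} {j} (here refl)) ⟩
  uncovered cs - (miss cs j - 0ℚ)
    ≡⟨ cong (λ t → uncovered cs - t) (+-identityʳ (miss cs j)) ⟩
  uncovered cs - miss cs j                                ∎
  where
  open ≡-Reasoning
  others : ∀ i → i ≢ j → miss cs i - miss (suc j ∷ cs) i ≡ 0ℚ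
  others i i≢j with miss-cases cs i
  ... | inj₁ (i∈cs , eq) = cong₂ _-_ eq (miss-∈ {cs = suc j ∷ cs} {i} (there i∈cs))
  ... | inj₂ (i∉cs , eq) = cong₂ _-_ eq (miss-∉ {cs = suc j ∷ cs} {i} λ { (here refl) →
      i≢j refl ; (there i∈cs) → i∉cs i∈cs })

miss≤1 : ∀ {k} cs (i : Fin k) → miss cs i ≤ 1ℚ
miss≤1 cs i with miss-cases cs i
... | inj₁ (_ , eq) = subst (_≤ 1ℚ) (sym eq) 0≤1ℚ
... | inj₂ (_ , eq) = ≤-reflexive eq

uncovered-∷ : ∀ {k} c (cs : List (Fin (suc k))) → uncovered cs - 1ℚ ≤ uncovered (c ∷ cs)
uncovered-∷ zero cs = ≤-by-difference 1ℚ 0≤1ℚ (solve 1 (λ u →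
  u := (u :- con 1ℚ) :+ con 1ℚ) refl (uncovered cs))
uncovered-∷ (suc j) cs = subst (uncovered cs - 1ℚ ≤_) (sym (uncovered-suc j cs))
  (+-monoʳ-≤ (uncovered cs) (neg-antimono-≤ (miss≤1 cs j)))

uncovered-[] : ∀ k → uncovered {k} [] ≡ ℕtoℚ k
uncovered-[] k = trans (sumℚ-const 1ℚ (allFin k))
  (trans (*-identityˡ (ℕtoℚ (length (allFin k)))) (cong ℕtoℚ (length-tabulate {n = k} id)))

costTo-covered : ∀ {k cs} (a : Fin (suc k)) → a ∈ cs → costTo (pt a) (map pt cs) ≡ 0ℚ
costTo-covered {cs = cs} a a∈cs =
  ≤-antisym (≤-trans (costTo≤ (∈-map⁺ pt a∈cs)) (≤-reflexive (dist²-refl (pt a))))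
  (0≤costTo (pt a) (map pt cs))

≤costTo-pt : ∀ {k t} (a c : Fin (suc k)) cs → (∀ {b} → b ∈ c ∷ cs → t ≤ dist² (pt a) (pt b)) →
  t ≤ costTo (pt a) (map pt (c ∷ cs))
≤costTo-pt a c cs t≤ = ≤costTo (pt a) (pt c) (map pt cs) λ c'∈ → let (b , b∈ , eq) = ∈-map⁻ pt c'∈ in
  subst (λ y → _ ≤ dist² (pt a) y) (sym eq) (t≤ b∈)

miss≤costTo : ∀ {k} c cs (i : Fin k) → miss (c ∷ cs) i ≤ costTo (unit i) (map pt (c ∷ cs))
miss≤costTo c cs i with miss-cases (c ∷ cs) i
... | inj₁ (_ , eq) = subst (_≤ costTo (unit i) (map pt (c ∷ cs))) (sym eq)
    (0≤costTo (unit i) (map pt (c ∷ cs)))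
... | inj₂ (i∉ , eq) = subst (_≤ costTo (unit i) (map pt (c ∷ cs))) (sym eq)
    (≤costTo-pt (suc i) c cs (λ {b} b∈ → 1≤dist² (suc i) b λ { refl → i∉ b∈ }))

costTo-origin : ∀ {k} (j : Fin k) js → costTo origin (map pt (map suc (j ∷ js))) ≡ 1ℚ
costTo-origin j js = ≤-antisym
  (≤-trans (costTo≤ {x = origin} {C = map pt (map suc (j ∷ js))} (here refl))
  (≤-reflexive (dist²-origin-unit j)))
  (≤costTo-pt zero (suc j) (map suc js) λ b∈ → let (i , _ , eq) = ∈-map⁻ suc {xs = j ∷ js} b∈ in
    subst (λ b → 1ℚ ≤ dist² origin (pt b)) (sym eq) (≤-reflexive (sym (dist²-origin-unit i))))

-- Centers of the form `map suc (j ∷ js)` are nonempty and exclude the origin; an uncovered unit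
-- vector is then at squared distance 2 from each of them.
costTo-unit : ∀ {k} (j : Fin k) js i →
  costTo (unit i) (map pt (map suc (j ∷ js))) ≡ 2ℚ * miss (map suc (j ∷ js)) i
costTo-unit j js i with miss-cases (map suc (j ∷ js)) i
... | inj₁ (i∈ , eq) = trans (costTo-covered (suc i) i∈) (cong (2ℚ *_) (sym eq))
... | inj₂ (i∉ , eq) = trans (≤-antisym
      (≤-trans (costTo≤ {x = unit i} {C = map pt (map suc (j ∷ js))} (here refl))
        (≤-reflexive (dist²-unit-unit {i = i} {j} λ { refl → i∉ (here refl) })))
      (≤costTo-pt (suc i) (suc j) (map suc js) λ b∈ → let (i′ , _ , eq′) = ∈-map⁻ suc {xs = j ∷ js} b∈ in
         subst (λ b → 2ℚ ≤ dist² (unit i) (pt b)) (sym eq′)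
           (≤-reflexive (sym (dist²-unit-unit {i = i} {i′} λ { refl →
           i∉ (subst (_∈ map suc (j ∷ js)) eq′ b∈) })))))
    (cong (2ℚ *_) (sym eq))

-- Distinct points of the instance are at squared distance at least 1, so this holds with or without
-- the origin among the centers.
uncovered≤Φ : ∀ {k} M c (cs : List (Fin (suc k))) →
  ℕtoℚ M * uncovered (c ∷ cs) ≤ Φ (points k M) (map pt (c ∷ cs))
uncovered≤Φ {k} M c cs = begin
  ℕtoℚ M * uncovered (c ∷ cs)        ≤⟨ *-monoʳ (0≤ℕtoℚ M) (sumℚ-mono (miss≤costTo c cs) (allFin k)) ⟩
  ℕtoℚ M * ∑ (λ i → costTo (unit i) C)
    ≤⟨ ≤-by-difference (costTo origin C) (0≤costTo origin C)
    (+-comm (costTo origin C) (ℕtoℚ M * ∑ (λ i → costTo (unit i) C))) ⟩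
  costTo origin C + ℕtoℚ M * ∑ (λ i → costTo (unit i) C) ≡⟨ Φ-instance k M C ⟨
  Φ (points k M) C ∎
  where
  open ≤-Reasoning
  C = map pt (c ∷ cs)

Φ-units : ∀ {k} M (j : Fin k) js →
  Φ (points k M) (map pt (map suc (j ∷ js))) ≡ 1ℚ + ℕtoℚ M * (2ℚ * uncovered (map suc (j ∷ js)))
Φ-units {k} M j js = trans (Φ-instance k M (map pt (map suc (j ∷ js))))
  (cong₂ (λ s t → s + ℕtoℚ M * t) (costTo-origin j js)
    (trans (cong sumℚ (map-cong (costTo-unit j js) (allFin k)))
      (sumℚ-*ˡ 2ℚ (miss (map suc (j ∷ js))) (allFin k))))

-- The origin serves every uncovered unit vector at squared distance 1 and itself for free, whatever
-- the other centers are.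
Φ-origin∷≤ : ∀ {k} M (cs : List (Fin (suc k))) →
  Φ (points k M) (map pt (zero ∷ cs)) ≤ ℕtoℚ M * uncovered cs
Φ-origin∷≤ {k} M cs = begin
  Φ (points k M) C                                ≡⟨ Φ-instance k M C ⟩
  costTo origin C + ℕtoℚ M * ∑ (λ i → costTo (unit i) C)
    ≡⟨ cong (_+ ℕtoℚ M * ∑ (λ i → costTo (unit i) C)) 
         (costTo-covered {cs = zero ∷ cs} zero (here refl)) ⟩
  0ℚ + ℕtoℚ M * ∑ (λ i → costTo (unit i) C)
    ≡⟨ +-identityˡ (ℕtoℚ M * ∑ (λ i → costTo (unit i) C)) ⟩
  ℕtoℚ M * ∑ (λ i → costTo (unit i) C)
    ≤⟨ *-monoʳ (0≤ℕtoℚ M) (sumℚ-mono below (allFin k)) ⟩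
  ℕtoℚ M * uncovered cs                                    ∎
  where
  open ≤-Reasoning
  C = map pt (zero ∷ cs)
  below : ∀ i → costTo (unit i) C ≤ miss cs i
  below i with miss-cases cs i
  ... | inj₁ (i∈cs , eq) = ≤-reflexive
      (trans (costTo-covered {cs = zero ∷ cs} (suc i) (there i∈cs)) (sym eq))
  ... | inj₂ (_ , eq) = ≤-trans (costTo≤ {c = origin} {C = C} (here refl))
      (≤-reflexive (trans (dist²-unit-origin i) (sym eq)))

-- Positivity of all costs, and the upper bound 1 on the optimum.

∈-labels : ∀ {k M} → 1 ℕ.≤ M → ∀ a → a ∈ labels k M
∈-labels _ zero = here refl
∈-labels {k} {suc M} _ (suc i) =
  there (∈-concat⁺′ (here refl) (∈-map⁺ (λ i → replicate (suc M) (suc i)) (∈-allFin i)))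

pt-injective : ∀ {k} {a b : Fin (suc k)} → pt a ≡ pt b → a ≡ b
pt-injective {a = a} {b} eq with a Fin.≟ b
... | yes a≡b = a≡b
... | no a≢b = contradiction
    (≤-trans (1≤dist² a b a≢b) (≤-reflexive (trans (cong (dist² (pt a)) (sym eq)) (dist²-refl (pt a)))))
    (from-no (1ℚ ≤? 0ℚ))

costTo≤0⇒≡lookup : ∀ {d n} (x : Point d) (C : Vec (Point d) (suc n)) → costTo x (Vec.toList C) ≤ 0ℚ →
  ∃ λ i → x ≡ Vec.lookup C i
costTo≤0⇒≡lookup x (c Vec.∷ C) le with costTo-attained x c (Vec.toList C)
... | y , y∈ , eq = VecAny.index y∈C , trans (dist²≤0⇒≡ x y (subst (_≤ 0ℚ) eq le)) (lookup-index y∈C)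
  where y∈C = Vec.∈-toList⁻ {xs = c Vec.∷ C} y∈

-- At cost 0 each of the k + 1 distinct points would be one of the k centers, against the pigeonhole
-- principle.
0<Φ-instance : ∀ {k M} → 1 ℕ.≤ k → 1 ℕ.≤ M → (C : Vec (Point k) k) → 0ℚ < Φ (points k M) (Vec.toList C)
0<Φ-instance {suc k} {M} _ 1≤M C with 0ℚ <? Φ (points (suc k) M) (Vec.toList C)
... | yes 0<Φ = 0<Φ
... | no Φ≮0 = contradiction
    (pt-injective (trans (centre-correct i) (trans (cong (Vec.lookup C) same) (sym (centre-correct j)))))
    (Fin.<⇒≢ i<j)
  where
  centre-at : ∀ a → ∃ λ i → pt a ≡ Vec.lookup C i
  centre-at a = costTo≤0⇒≡lookup (pt a) C
    (≤-trans (∈⇒≤sumℚ (λ x → 0≤costTo x (Vec.toList C)) (∈-map⁺ pt (∈-labels 1≤M a))) (≮⇒≥ Φ≮0))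
  centre : Fin (suc (suc k)) → Fin (suc k)
  centre a = proj₁ (centre-at a)
  centre-correct : ∀ a → pt a ≡ Vec.lookup C (centre a)
  centre-correct a = proj₂ (centre-at a)
  clash = Fin.pigeonhole (ℕ.n<1+n (suc k)) centre
  i = proj₁ clash
  j = proj₁ (proj₂ clash)
  i<j = proj₁ (proj₂ (proj₂ clash))
  same = proj₂ (proj₂ (proj₂ clash))

Φ-all-units≤1 : ∀ {k} M → 1 ℕ.≤ k → Φ (points k M) (Vec.toList (Vec.tabulate unit)) ≤ 1ℚ
Φ-all-units≤1 {suc k} M _ = begin
  Φ (points (suc k) M) C                          ≡⟨ Φ-instance (suc k) M C ⟩
  costTo origin C + ℕtoℚ M * ∑ (λ i → costTo (unit i) C)
    ≡⟨ cong (λ t → costTo origin C + ℕtoℚ M * t) ∑≡0 ⟩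
  costTo origin C + ℕtoℚ M * 0ℚ
    ≡⟨ trans (cong (costTo origin C +_) (*-zeroʳ (ℕtoℚ M))) (+-identityʳ (costTo origin C)) ⟩
  costTo origin C                                          ≤⟨ costTo≤ {C = C} (here refl) ⟩
  dist² origin (unit {suc k} zero)                         ≡⟨ dist²-origin-unit {suc k} zero ⟩
  1ℚ                                                       ∎
  where
  open ≤-Reasoning
  C = Vec.toList (Vec.tabulate unit)
  cost≡0 : ∀ i → costTo (unit i) C ≡ 0ℚ
  cost≡0 i = ≤-antisym (≤-trans (costTo≤ {C = C} (Vec.∈-toList⁺ (Vec.∈-tabulate⁺ unit i)))
    (≤-reflexive (dist²-refl (unit i)))) (0≤costTo (unit i) C)
  ∑≡0 : ∑ (λ i → costTo (unit i) C) ≡ 0ℚ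
  ∑≡0 = trans (cong sumℚ (map-cong cost≡0 (allFin (suc k))))
    (trans (sumℚ-const 0ℚ (allFin (suc k))) (*-zeroˡ (ℕtoℚ (length (allFin (suc k))))))

-- Expected cost of a greedy run in terms of the deficit.

a-b*x≤a : ∀ {a b x} → 0ℚ ≤ b → 0ℚ ≤ x → a - b * x ≤ a
a-b*x≤a {a} {b} {x} 0≤b 0≤x =
  ≤-by-difference (b * x) (0≤* 0≤b 0≤x) (solve 2 (λ a y → a := (a :- y) :+ y) refl a (b * x))

-- Each step covers at most one unit vector, so one of them remains uncovered at the end.
greedyExp-missed : ∀ {k} M l m c (cs : List (Fin (suc k))) → 1 ℕ.≤ M →
  ℕtoℚ (suc m) ≤ uncovered (c ∷ cs) →
  ℕtoℚ M ≤ greedyExp (suc l) (points k M) m (map pt (c ∷ cs))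
greedyExp-missed {k} M l m c cs 1≤M m<u = go m m<u
  where
  X = points k M
  C = map pt (c ∷ cs)
  M≤Φ : ℕtoℚ M ≤ Φ X C
  M≤Φ = begin
    ℕtoℚ M                       ≡⟨ *-identityʳ (ℕtoℚ M) ⟨
    ℕtoℚ M * 1ℚ
      ≤⟨ *-monoʳ (0≤ℕtoℚ M) (≤-trans (ℕtoℚ-mono-≤ {1} {suc m} (s≤s z≤n)) m<u) ⟩
    ℕtoℚ M * uncovered (c ∷ cs)  ≤⟨ uncovered≤Φ M c cs ⟩
    Φ X C                        ∎
    where open ≤-Reasoning
  go : ∀ m → ℕtoℚ (suc m) ≤ uncovered (c ∷ cs) → ℕtoℚ M ≤ greedyExp (suc l) X m C
  go zero _ = M≤Φ
  go (suc m) m<u = greedyExp-step-≥ pt (labels k M) l m C (ℕtoℚ M) (<-≤-trans (0<ℕtoℚ 1≤M) M≤Φ) next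
    where
    next : ∀ t T → ℕtoℚ M ≤ greedyExp (suc l) X m (bestFrom X C (pt t) (map pt T) ∷ C)
    next t T = let (w , eq) = bestFrom-label pt X C t T in
      subst (λ x → ℕtoℚ M ≤ greedyExp (suc l) X m (x ∷ C)) (sym eq)
        (greedyExp-missed M l m w (c ∷ cs) 1≤M (≤-trans
          (subst (_≤ uncovered (c ∷ cs) - 1ℚ) (ℕtoℚ-suc-1 (suc m)) (+-monoˡ-≤ (- 1ℚ) m<u))
          (uncovered-∷ w (c ∷ cs))))

-- The share of the uncovered unit vectors in the cost when m of them are uncovered and the origin
-- is not a center; the origin itself contributes 1.
unit-cost : ℕ → ℕ → ℚ
unit-cost M m = ℕtoℚ M * (2ℚ * ℕtoℚ m)

evade : ℕ → ℕ → ℚ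
evade M m = unit-cost M m /' (1ℚ + unit-cost M m)

-- M times a bound on the probability that the origin is never taken from a state with n + 1
-- uncovered unit vectors; with a single one left the origin is not preferred, whence the value M at n = 0.
deficit : ℕ → ℕ → ℕ → ℚ
deficit M ℓ zero = ℕtoℚ M
deficit M ℓ (suc n) = deficit M ℓ n * evade M (2 ℕ.+ n) ^ ℓ

0≤unit-cost : ∀ M m → 0ℚ ≤ unit-cost M m
0≤unit-cost M m = 0≤* (0≤ℕtoℚ M) (0≤* 0≤2ℚ (0≤ℕtoℚ m))

0<1+unit-cost : ∀ M m → 0ℚ < 1ℚ + unit-cost M m
0<1+unit-cost M m = <-≤-trans (from-yes (0ℚ <? 1ℚ))
  (≤-by-difference (unit-cost M m) (0≤unit-cost M m) refl)

0≤evade : ∀ M m → 0ℚ ≤ evade M m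
0≤evade M m = 0≤/' (0≤unit-cost M m) (0<1+unit-cost M m)

evade≤1 : ∀ M m → evade M m ≤ 1ℚ
evade≤1 M m = *-cancelʳ (0<1+unit-cost M m)
  (subst₂ _≤_ (sym (/'-* (unit-cost M m) (0<1+unit-cost M m))) (sym (*-identityˡ (1ℚ + unit-cost M m)))
  (≤-by-difference 1ℚ 0≤1ℚ (+-comm 1ℚ (unit-cost M m))))

0≤deficit : ∀ M ℓ n → 0ℚ ≤ deficit M ℓ n
0≤deficit M ℓ zero = 0≤ℕtoℚ M
0≤deficit M ℓ (suc n) = 0≤* (0≤deficit M ℓ n) (0≤^ ℓ (0≤evade M (2 ℕ.+ n)))

-- Plays `χ` in `greedyExp-step`: its product over a sample is the indicator that the origin was not
-- drawn.
unit? : ∀ {k} → Fin (suc k) → ℚ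
unit? zero = 0ℚ
unit? (suc _) = 1ℚ

0≤unit? : ∀ {k} (a : Fin (suc k)) → 0ℚ ≤ unit? a
0≤unit? zero = ≤-refl
0≤unit? (suc _) = 0≤1ℚ

prodℚ-unit?≡1 : ∀ {k} (T : List (Fin (suc k))) → zero ∉ T → prodℚ (map unit? T) ≡ 1ℚ
prodℚ-unit?≡1 [] _ = refl
prodℚ-unit?≡1 (zero ∷ T) 0∉ = contradiction (here refl) 0∉
prodℚ-unit?≡1 (suc i ∷ T) 0∉ = trans (*-identityˡ (prodℚ (map unit? T))) (prodℚ-unit?≡1 T (0∉ ∘ there))

-- The factor `unit?` deletes the origin's term; the M copies of each of the m uncovered unit
-- vectors contribute 2 each out of the total 1 + 2Mm.
evade-probability : ∀ {k} M m (j : Fin k) js → uncovered (map suc (j ∷ js)) ≡ ℕtoℚ m →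
  let C = map pt (map suc (j ∷ js)) in
  sumℚ (map (λ a → unit? a * (costTo (pt a) C /' Φ (points k M) C)) (labels k M)) ≡ evade M m
evade-probability {k} M m j js u≡m = *-cancelʳ-≡ (0<1+unit-cost M m) (begin
  sumℚ (map (λ a → unit? a * p a) (labels k M)) * (1ℚ + unit-cost M m)
    ≡⟨ sumℚ-*ʳ (1ℚ + unit-cost M m) (λ a → unit? a * p a) (labels k M) ⟨
  sumℚ (map (λ a → unit? a * p a * (1ℚ + unit-cost M m)) (labels k M))
    ≡⟨ cong sumℚ (map-cong cancel (labels k M)) ⟩
  sumℚ (map (λ a → unit? a * costTo (pt a) C) (labels k M))
    ≡⟨ sumℚ-labels k M (λ a → unit? a * costTo (pt a) C) ⟩
  0ℚ * costTo origin C + ℕtoℚ M * ∑ (λ i → 1ℚ * costTo (unit i) C)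
    ≡⟨ cong₂ (λ s t → s + ℕtoℚ M * t) (*-zeroˡ (costTo origin C))
    (cong sumℚ (map-cong (λ i →
    trans (*-identityˡ (costTo (unit i) C)) (costTo-unit j js i)) (allFin k))) ⟩
  0ℚ + ℕtoℚ M * ∑ (λ i → 2ℚ * miss (map suc (j ∷ js)) i)
    ≡⟨ +-identityˡ (ℕtoℚ M * ∑ (λ i → 2ℚ * miss (map suc (j ∷ js)) i)) ⟩
  ℕtoℚ M * ∑ (λ i → 2ℚ * miss (map suc (j ∷ js)) i)
    ≡⟨ cong (ℕtoℚ M *_) (trans (sumℚ-*ˡ 2ℚ (miss (map suc (j ∷ js))) (allFin k)) (cong (2ℚ *_) u≡m)) ⟩
  unit-cost M m
    ≡⟨ /'-* (unit-cost M m) (0<1+unit-cost M m) ⟨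
  evade M m * (1ℚ + unit-cost M m)                                       ∎)
  where
  open ≡-Reasoning
  C = map pt (map suc (j ∷ js))
  p : Fin (suc k) → ℚ
  p a = costTo (pt a) C /' Φ (points k M) C
  Φ≡ : Φ (points k M) C ≡ 1ℚ + unit-cost M m
  Φ≡ = trans (Φ-units M j js) (cong (λ u → 1ℚ + ℕtoℚ M * (2ℚ * u)) u≡m)
  cancel : ∀ a → unit? a * p a * (1ℚ + unit-cost M m) ≡ unit? a * costTo (pt a) C
  cancel a = trans (*-assoc (unit? a) (p a) (1ℚ + unit-cost M m)) (cong (unit? a *_)
    (trans (cong (λ D → costTo (pt a) C /' D * (1ℚ + unit-cost M m)) Φ≡)
      (/'-* (costTo (pt a) C) (0<1+unit-cost M m))))

-- With u unit vectors uncovered, the origin leaves cost at most Mu, a unit vector at least 1 + 2M(u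
-- - 1). At u = 2 the multiples of M agree, and the 1 paid for the origin itself makes the
-- comparison strict.
origin-preferred : ∀ {k} M n (j : Fin k) js → uncovered (map suc (j ∷ js)) ≡ ℕtoℚ (2 ℕ.+ n) →
  ∀ a → a ≡ zero ⊎
        Φ (points k M) (map pt (zero ∷ map suc (j ∷ js))) < Φ (points k M) (map pt (a ∷ map suc (j ∷ js)))
origin-preferred M n j js u≡ zero = inj₁ refl
origin-preferred {k} M n j js u≡ (suc i) = inj₂ (begin-strict
  Φ X (map pt (zero ∷ cs))    ≤⟨ Φ-origin∷≤ M cs ⟩
  ℕtoℚ M * u                  ≤⟨ *-monoʳ (0≤ℕtoℚ M) u≤2u′ ⟩
  ℕtoℚ M * (2ℚ * u′)          ≡⟨ +-identityˡ (ℕtoℚ M * (2ℚ * u′)) ⟨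
  0ℚ + ℕtoℚ M * (2ℚ * u′)     <⟨ +-monoˡ-< (ℕtoℚ M * (2ℚ * u′)) (from-yes (0ℚ <? 1ℚ)) ⟩
  1ℚ + ℕtoℚ M * (2ℚ * u′)     ≡⟨ Φ-units M i (j ∷ js) ⟨
  Φ X (map pt (suc i ∷ cs))   ∎)
  where
  open ≤-Reasoning
  X = points k M
  cs = map suc (j ∷ js)
  u = uncovered cs
  u′ = uncovered (suc i ∷ cs)
  2≤u : 2ℚ ≤ u
  2≤u = subst (2ℚ ≤_) (sym u≡) (ℕtoℚ-mono-≤ {2} {2 ℕ.+ n} (s≤s (s≤s z≤n)))
  u≤2u′ : u ≤ 2ℚ * u′
  u≤2u′ = ≤-trans
    (≤-by-difference (u - 2ℚ) (0≤q-p 2≤u) (solve 1 (λ u →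
      con 2ℚ :* (u :- con 1ℚ) := u :+ (u :- con 2ℚ)) refl u))
    (*-monoʳ {2ℚ} 0≤2ℚ (uncovered-∷ (suc i) cs))

-- The invariant is that the number of steps left equals the number of uncovered unit vectors.
-- Covering a new one lowers both; any other choice leaves too few steps, and `greedyExp-missed`
-- gives M.
greedyExp-units : ∀ {k} M l n (j : Fin k) js → 1 ℕ.≤ M → uncovered (map suc (j ∷ js)) ≡ ℕtoℚ (suc n) →
  ℕtoℚ M - deficit M (suc l) n ≤ greedyExp (suc l) (points k M) (suc n) (map pt (map suc (j ∷ js)))
greedyExp-units {k} M l n j js 1≤M u≡ = go n u≡
  where
  X = points k M
  cs = map suc (j ∷ js)
  C = map pt cs
  Mℚ = ℕtoℚ M
  0<Φ : 0ℚ < Φ X C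
  0<Φ = subst (0ℚ <_) (sym (trans (Φ-units M j js) (cong (λ u → 1ℚ + Mℚ * (2ℚ * u)) u≡)))
    (0<1+unit-cost M (suc n))
  go : ∀ n → uncovered cs ≡ ℕtoℚ (suc n) → Mℚ - deficit M (suc l) n ≤ greedyExp (suc l) X (suc n) C
  -- Here `deficit` equals M, so the claim is only that costs are nonnegative.
  go zero u≡ = subst (_≤ greedyExp (suc l) X 1 C) (sym (+-inverseʳ Mℚ))
    (greedyExp-step-≥ pt (labels k M) l 0 C 0ℚ 0<Φ λ t T → 0≤Φ X (bestFrom X C (pt t) (map pt T) ∷ C))
  go (suc n) u≡ = subst (λ q → Mℚ - deficit M (suc l) n * q ^ suc l ≤ greedyExp (suc l) X (2 ℕ.+ n) C)
    (evade-probability M (2 ℕ.+ n) j js u≡)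
    (greedyExp-step pt (labels k M) l (suc n) C unit? Mℚ (deficit M (suc l) n) 0<Φ next)
    where
    missed : ∀ T w → ℕtoℚ (2 ℕ.+ n) ≤ uncovered (w ∷ cs) →
      Mℚ - deficit M (suc l) n * prodℚ (map unit? T) ≤ greedyExp (suc l) X (suc n) (pt w ∷ C)
    missed T w n<u = ≤-trans (a-b*x≤a (0≤deficit M (suc l) n) (0≤prodℚ 0≤unit? T))
      (greedyExp-missed M l (suc n) w cs 1≤M n<u)
    picked : ∀ T → zero ∉ T → ∀ w →
      Mℚ - deficit M (suc l) n * prodℚ (map unit? T) ≤ greedyExp (suc l) X (suc n) (pt w ∷ C)
    picked T 0∉T zero = missed T zero (≤-reflexive (sym u≡))
    picked T 0∉T (suc i) with miss-cases cs i
    -- A repeated center wastes the step: n + 2 unit vectors stay uncovered with n + 1 steps left.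
    -- This avoids arguing that covered points have sampling probability 0.
    ... | inj₁ (_ , eq) = missed T (suc i)
        (≤-reflexive (sym (trans (uncovered-suc i cs)
        (trans (cong₂ _-_ u≡ eq) (+-identityʳ (ℕtoℚ (2 ℕ.+ n)))))))
    ... | inj₂ (_ , eq) = subst (λ x → Mℚ - x ≤ greedyExp (suc l) X (suc n) (unit i ∷ C))
      (sym (trans (cong (deficit M (suc l) n *_) (prodℚ-unit?≡1 T 0∉T))
        (*-identityʳ (deficit M (suc l) n))))
      (greedyExp-units M l n i (j ∷ js) 1≤M
        (trans (uncovered-suc i cs) (trans (cong₂ _-_ u≡ eq) (ℕtoℚ-suc-1 (suc n)))))
    next : ∀ t T → Mℚ - deficit M (suc l) n * prodℚ (map unit? (t ∷ T)) ≤
      greedyExp (suc l) X (suc n) (bestFrom X C (pt t) (map pt T) ∷ C)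
    next t T with _∈?_ Fin._≟_ zero (t ∷ T)
    ... | yes 0∈T = subst (λ x → _ ≤ greedyExp (suc l) X (suc n) (x ∷ C))
      (sym (bestFrom-strict-minimiser pt X C zero (origin-preferred M n j js u≡) t T 0∈T))
        (missed (t ∷ T) zero (≤-reflexive (sym u≡)))
    ... | no 0∉T = let (w , eq) = bestFrom-label pt X C t T in
      subst (λ x → _ ≤ greedyExp (suc l) X (suc n) (x ∷ C)) (sym eq) (picked (t ∷ T) 0∉T w)

-- Bounding the deficit by the harmonic sum.

-- A product of factors 1 + w/a dominates 1 plus the sum of the w/a, because (a + h)(a + w) = a (a +
-- h + w) + hw. The last hypothesis says r ≤ a/(a + w), since w = 1/m.
deficit-step : ∀ {G r a h w m B} → 0ℚ < a → 0ℚ ≤ G → 0ℚ ≤ r → 0ℚ ≤ h → 0ℚ ≤ w → w * m ≡ 1ℚ →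
  G * (a + h) ≤ a * B → r * (a * m + 1ℚ) ≤ a * m → (G * r) * (a + (h + w)) ≤ a * B
deficit-step {G} {r} {a} {h} {w} {m} {B} 0<a 0≤G 0≤r 0≤h 0≤w wm≡1 ih r≤ = *-cancelʳ 0<a (begin
  (G * r) * (a + (h + w)) * a
    ≤⟨ ≤-by-difference (G * r * (h * w)) (0≤* (0≤* 0≤G 0≤r) (0≤* 0≤h 0≤w)) (solve 5 (λ G r a h w →
    (G :* (a :+ h)) :* (r :* (a :+ w)) := (G :* r) :* (a :+ (h :+ w)) :* a :+ G :* r :* (h :* w))
    refl G r a h w) ⟩
  (G * (a + h)) * (r * (a + w))        ≤⟨ *-monoʳ (0≤* 0≤G (0≤+ (<⇒≤ 0<a) 0≤h)) r[a+w]≤a ⟩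
  (G * (a + h)) * a                    ≤⟨ *-monoˡ (<⇒≤ 0<a) ih ⟩
  a * B * a                            ∎)
  where
  open ≤-Reasoning
  r[a+w]≤a : r * (a + w) ≤ a
  r[a+w]≤a = begin
    r * (a + w)
      ≡⟨ cong (λ t → r * (t + w)) (trans (sym (*-identityʳ a)) (cong (a *_) (sym wm≡1))) ⟩
    r * (a * (w * m) + w)
      ≡⟨ solve 4 (λ r a w m → r :* (a :* (w :* m) :+ w) := r :* (a :* m :+ con 1ℚ) :* w) refl r a w m ⟩
    r * (a * m + 1ℚ) * w       ≤⟨ *-monoˡ 0≤w r≤ ⟩
    a * m * w                  ≡⟨ solve 3 (λ a m w → a :* m :* w := a :* (w :* m)) refl a m w ⟩
    a * (w * m)                ≡⟨ trans (cong (a *_) wm≡1) (*-identityʳ a) ⟩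
    a                          ∎

-- Bernoulli with N = 2Mm. As M = ℓL, a factor ℓ cancels from N + ℓ and from N, which leaves a bound
-- free of ℓ.
evade^ℓ≤ : ∀ ℓ L m → 1 ℕ.≤ ℓ →
  evade (ℓ ℕ.* L) m ^ ℓ * (2ℚ * ℕtoℚ L * ℕtoℚ m + 1ℚ) ≤ 2ℚ * ℕtoℚ L * ℕtoℚ m
evade^ℓ≤ ℓ L m 1≤ℓ = *-cancelʳ (0<ℕtoℚ 1≤ℓ) (begin
  r * (2ℚ * l * x + 1ℚ) * y
    ≡⟨ solve 4 (λ r l x y → r :* (con 2ℚ :* l :* x :+ con 1ℚ) :* y := r :*
    (y :* l :* (con 2ℚ :* x) :+ y)) refl r l x y ⟩
  r * (y * l * (2ℚ * x) + y)  ≡⟨ cong (λ t → r * (t * (2ℚ * x) + y)) (ℕtoℚ-* ℓ L) ⟨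
  r * (unit-cost M m + y)
    ≤⟨ q^ℓ*[N+ℓ]≤N ℓ (0≤evade M m) (evade≤1 M m) (/'-* (unit-cost M m) (0<1+unit-cost M m)) ⟩
  unit-cost M m               ≡⟨ cong (_* (2ℚ * x)) (ℕtoℚ-* ℓ L) ⟩
  y * l * (2ℚ * x)
    ≡⟨ solve 3 (λ l x y → y :* l :* (con 2ℚ :* x) := con 2ℚ :* l :* x :* y) refl l x y ⟩
  2ℚ * l * x * y              ∎)
  where
  open ≤-Reasoning
  M = ℓ ℕ.* L
  r = evade M m ^ ℓ
  l = ℕtoℚ L
  x = ℕtoℚ m
  y = ℕtoℚ ℓ

-- The factor of `deficit` and the term of `harmonic` added at the successor of n both belong to m =
-- n + 2, so the two recursions advance together.
deficit-harmonic : ∀ ℓ L n → 1 ℕ.≤ ℓ → 1 ℕ.≤ L →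
  deficit (ℓ ℕ.* L) ℓ n * (2ℚ * ℕtoℚ L + harmonic n) ≤ 2ℚ * ℕtoℚ L * ℕtoℚ (ℓ ℕ.* L)
deficit-harmonic ℓ L zero _ _ =
  ≤-reflexive (solve 2 (λ a M → M :* (a :+ con 0ℚ) := a :* M) refl (2ℚ * ℕtoℚ L) (ℕtoℚ (ℓ ℕ.* L)))
deficit-harmonic ℓ L (suc n) 1≤ℓ 1≤L = deficit-step
  (subst (_< 2ℚ * ℕtoℚ L) (*-zeroʳ 2ℚ) (*-monoʳ-<-pos 2ℚ (0<ℕtoℚ 1≤L)))
  (0≤deficit (ℓ ℕ.* L) ℓ n) (0≤^ ℓ (0≤evade (ℓ ℕ.* L) (2 ℕ.+ n))) (0≤harmonic n)
  (0≤/' 0≤1ℚ (0<2+n n)) (/'-* 1ℚ (0<2+n n))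
  (deficit-harmonic ℓ L n 1≤ℓ 1≤L) (evade^ℓ≤ ℓ L (2 ℕ.+ n) 1≤ℓ)

1/9 : ℚ
1/9 = ℤ.+ 1 / 9

-- Since 4h ≥ 2(L - 1) ≥ L, the last hypothesis yields 9G ≤ 8M.
success-probability : ∀ {G L h M} → 2ℚ ≤ L → L ≤ 1ℚ + 2ℚ * h → 0ℚ ≤ G → G * (2ℚ * L + h) ≤ 2ℚ * L * M →
  1/9 * M ≤ M - G
success-probability {G} {L} {h} {M} 2≤L L≤ 0≤G pot =
  *-cancelʳ {L} {1/9 * M} {M - G} (<-≤-trans (from-yes (0ℚ <? 2ℚ)) 2≤L)
  -- Nine times the difference is 8LM - 9GL, written as a combination of `pot`, `L≤` and `2≤L` with
  -- multipliers 4, 2G and G, in which h cancels.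
  (≤-by-difference (1/9 * (4ℚ * (2ℚ * L * M - G * (2ℚ * L + h))) + 1/9 *
    (G * (2ℚ * (1ℚ + 2ℚ * h - L) + (L - 2ℚ))))
    (0≤+ (0≤* (from-yes (0ℚ ≤? 1/9)) (0≤* (from-yes (0ℚ ≤? 4ℚ)) (0≤q-p pot)))
         (0≤* (from-yes (0ℚ ≤? 1/9)) (0≤* 0≤G (0≤+ (0≤* 0≤2ℚ (0≤q-p L≤)) (0≤q-p 2≤L)))))
    (solve 4 (λ G L h M → (M :- G) :* L := con 1/9 :* M :* L :+
      (con 1/9 :* (con 4ℚ :* (con 2ℚ :* L :* M :- G :* (con 2ℚ :* L :+ h))) :+ con 1/9 :*
      (G :* (con 2ℚ :* (con 1ℚ :+ con 2ℚ :* h :- L) :+ (L :- con 2ℚ)))))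
      refl G L h M))
  where 4ℚ = 2ℚ + 2ℚ

-- The uniform first center, and the approximation ratio.

sample-cost≥ : ∀ {d} {A : Set} k l (pt : A → Point d) as a → 1 ℕ.≤ length as →
  (∀ t → a ≤ greedyExp l (map pt as) (k ℕ.∸ 1) (pt t ∷ [])) →
  a ≤ greedyKMeansPPExpectedCost k l (map pt as)
sample-cost≥ k l pt as a 1≤length a≤ =
  ≤-/' (0<ℕtoℚ (subst (1 ℕ.≤_) (sym (length-map pt as)) 1≤length)) (begin
  a * ℕtoℚ (length (map pt as))
    ≡⟨ cong (λ n → a * ℕtoℚ n) (length-map pt as) ⟩
  a * ℕtoℚ (length as)                                              ≡⟨ sumℚ-const a as ⟨
  sumℚ (map (λ _ → a) as)                                           ≤⟨ sumℚ-mono a≤ as ⟩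
  sumℚ (map (λ t → greedyExp l (map pt as) (k ℕ.∸ 1) (pt t ∷ [])) as)
    ≡⟨ cong sumℚ (map-∘ {g = λ x → greedyExp l (map pt as) (k ℕ.∸ 1) (x ∷ [])} {f = pt} as) ⟩
  sumℚ (map (λ x → greedyExp l (map pt as) (k ℕ.∸ 1) (x ∷ [])) (map pt as)) ∎)
  where open ≤-Reasoning

-- With k = n + 2, a first center at a unit vector starts the invariant with n + 1 uncovered and n +
-- 1 steps left; a first center at the origin leaves all n + 2 uncovered and forces M at once.
greedy-cost≥ : ∀ n l M → 1 ℕ.≤ M →
  ℕtoℚ M - deficit M (suc l) n ≤ greedyKMeansPPExpectedCost (2 ℕ.+ n) (suc l) (points (2 ℕ.+ n) M)
greedy-cost≥ n l M 1≤M = sample-cost≥ (2 ℕ.+ n) (suc l) pt (labels (2 ℕ.+ n) M)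
  (ℕtoℚ M - deficit M (suc l) n) (s≤s z≤n) first
  where
  first : ∀ a → ℕtoℚ M - deficit M (suc l) n ≤ greedyExp (suc l) (points (2 ℕ.+ n) M) (suc n) (pt a ∷ [])
  first zero = ≤-trans (≤-by-difference (deficit M (suc l) n) (0≤deficit M (suc l) n) (solve 2 (λ x y →
    x := (x :- y) :+ y) refl (ℕtoℚ M) (deficit M (suc l) n)))
    (greedyExp-missed {2 ℕ.+ n} M l (suc n) zero [] 1≤M (≤-reflexive (sym (uncovered-[] (2 ℕ.+ n)))))
  first (suc j) = greedyExp-units {2 ℕ.+ n} M l n j [] 1≤M
    (trans (uncovered-suc j []) (trans (cong (_- 1ℚ) (uncovered-[] (2 ℕ.+ n))) (ℕtoℚ-suc-1 (suc n))))

theorem1 : Σ ℚ (λ c → (0ℚ < c) × ((k ℓ : ℕ) → 4 ℕ.≤ k → 1 ℕ.≤ ℓ →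
    Σ (List (Point k)) (λ X → (X ≢ [])
    × ((C : Vec (Point k) k) → 0ℚ < Φ X (Vec.toList C))
    × Σ (Vec (Point k) k) (λ Copt →
    (c * bound k ℓ) * Φ X (Vec.toList Copt) ≤ greedyKMeansPPExpectedCost k ℓ X))))
theorem1 = 1/9 , from-yes (0ℚ <? 1/9) , construction
  where
  construction : (k ℓ : ℕ) → 4 ℕ.≤ k → 1 ℕ.≤ ℓ →
    Σ (List (Point k)) (λ X → (X ≢ [])
    × ((C : Vec (Point k) k) → 0ℚ < Φ X (Vec.toList C))
    × Σ (Vec (Point k) k) (λ Copt →
    (1/9 * bound k ℓ) * Φ X (Vec.toList Copt) ≤ greedyKMeansPPExpectedCost k ℓ X))
  construction (suc zero) (suc _) (s≤s ())
  construction k@(suc (suc n)) ℓ@(suc l) 4≤k 1≤ℓ =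
    -- The unit vectors serve as `Copt`; their cost is at least the optimum, so the inequality
    -- against it implies the one against the optimum.
    X , (λ ()) , 0<Φ-instance {k} (s≤s z≤n) 1≤M , Vec.tabulate unit , ratio
    where
    L = ⌊log₂ k ⌋
    M = ℓ ℕ.* L
    X = points k M
    2≤L : 2 ℕ.≤ L
    2≤L = subst (ℕ._≤ L) (⌊log₂[2^n]⌋≡n 2) (⌊log₂⌋-mono-≤ 4≤k)
    1≤L : 1 ℕ.≤ L
    1≤L = ℕ.≤-trans (s≤s z≤n) 2≤L
    1≤M : 1 ℕ.≤ M
    1≤M = ℕ.*-mono-≤ 1≤ℓ 1≤L
    OPT = Φ X (Vec.toList (Vec.tabulate unit))
    -- The minimum is at most ℓ, and ℓL is M.
    bound≤M : bound k ℓ ≤ ℕtoℚ M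
    bound≤M = subst (bound k ℓ ≤_) (sym (ℕtoℚ-* ℓ L))
      (*-monoˡ (0≤ℕtoℚ L) (p⊓q≤p (ℕtoℚ ℓ) (ℕtoℚ k /' ℕtoℚ L)))
    ratio : (1/9 * bound k ℓ) * OPT ≤ greedyKMeansPPExpectedCost k ℓ X
    ratio = begin
      (1/9 * bound k ℓ) * OPT
        ≤⟨ *-monoˡ (0≤Φ X (Vec.toList (Vec.tabulate unit))) (*-monoʳ (from-yes (0ℚ ≤? 1/9)) bound≤M) ⟩
      (1/9 * ℕtoℚ M) * OPT
        ≤⟨ *-monoʳ (0≤* (from-yes (0ℚ ≤? 1/9)) (0≤ℕtoℚ M)) (Φ-all-units≤1 {k} M (s≤s z≤n)) ⟩
      (1/9 * ℕtoℚ M) * 1ℚ            ≡⟨ *-identityʳ (1/9 * ℕtoℚ M) ⟩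
      1/9 * ℕtoℚ M
        ≤⟨ success-probability (ℕtoℚ-mono-≤ 2≤L) (log≤1+2harmonic n) (0≤deficit M ℓ n)
        (deficit-harmonic ℓ L n 1≤ℓ 1≤L) ⟩
      ℕtoℚ M - deficit M ℓ n         ≤⟨ greedy-cost≥ n l M 1≤M ⟩
      greedyKMeansPPExpectedCost k ℓ X ∎
      where open ≤-Reasoning
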